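{- Let $\Psi:\mathcal{T}\to\mathrm{Sym}$ be the unital algebra homomorphism determined by the requirement that $\Psi(X_\pi)=Y_{\mathrm{Kr}(\pi)}=\prod_{W\in\mathrm{Kr}(\pi)}Y_{|W|}$ for all $\pi\in\sqcup_{n=1}^\infty NC(n)$. Then $\Psi$ is a homomorphism of graded connected bialgebras.
   Context: $NC(n)$ is the set of non-crossing partitions of $\{1,\ldots,n\}$, ordered by reverse refinement ($\pi\le\sigma$ iff every block of $\sigma$ is a union of blocks of $\pi$); $1_n\in NC(n)$ is the partition with one block; $|\pi|$ is the number of blocks of $\pi$. For $\pi \in NC(n)$ and a non-empty $W = \{p_1 < \cdots < p_m\} \subseteq \{1,\ldots,n\}$, $\pi_W \in NC(m)$ is the partition for which $i,j$ are in the same block of $\pi_W$ iff $p_i,p_j$ are in the same block of $\pi$. Kreweras complement: for $\pi \in NC(n)$, $\mathrm{Kr}(\pi) \in NC(n)$ is the largest $\sigma \in NC(n)$ such that, placing $\pi$ on the points $1,\ldots,n$ and $\sigma$ on the points $1',\ldots,n'$, the union of $\pi$ and $\sigma$ is a non-crossing partition of the ordered set $1<1'<2<2'<\cdots<n<n'$. $\mathcal{T}=\mathbb{C}\bigl[X_\pi\mid\pi\in\sqcup_{n=1}^\infty(NC(n)\setminus\{1_n\})\bigr]$ is the commutative polynomial algebra, with the convention $X_{1_n}:=1_{\mathcal{T}}$. It is a graded connected bialgebra with: comultiplication the unital algebra homomorphism determined by $\Delta_{\mathcal{T}}(X_\pi)=\sum_{\sigma\in NC(n),\ \sigma\ge\pi}\bigl(\prod_{W\in\sigma}X_{\pi_W}\bigr)\otimes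 X_\sigma$; counit the unital algebra homomorphism determined by $\epsilon_{\mathcal{T}}(X_\pi)=0$ for $\pi\in\sqcup_n(NC(n)\setminus\{1_n\})$; grading such that $X_\pi$ has degree $|\pi|-1$ (and a monomial $X_{\pi_1}\cdots X_{\pi_k}$ has degree $\sum_i(|\pi_i|-1)$). $\mathrm{Sym}$ is the Hopf algebra of symmetric functions, in its incarnation as the commutative polynomial algebra $\mathbb{C}[Y_2,Y_3,\ldots,Y_n,\ldots]$, where the $Y_n$ are the parking-function symmetric functions, with the convention $Y_1:=1_{\mathrm{Sym}}$. For $\pi\in NC(n)$ put $Y_\pi:=\prod_{V\in\pi}Y_{|V|}$. The graded connected bialgebra structure of $\mathrm{Sym}$ is described by: comultiplication the unital algebra homomorphism with $\Delta(Y_n)=\sum_{\pi\in NC(n)}Y_\pi\otimes Y_{\mathrm{Kr}(\pi)}$ for $n\ge1$; counit the unital algebra homomorphism with $\varepsilon(Y_n)=0$ for $n\ge2$; grading such that $Y_n$ has degree $n-1$ (and $Y_{n_1}\cdots Y_{n_k}$ has degree $n_1+\cdots+n_k-k$). A homomorphism of graded connected bialgebras is a unital algebra homomorphism which respects the comultiplications, the counits and the gradings. -}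

module Defs where

import Level
open import Level using (_⊔_; 0ℓ)
open import Algebra.Bundles using (CommutativeRing)
open import Algebra.Morphism.Structures using (module RingMorphisms)
open import Data.Bool.Base using (Bool; true; false; _xor_; _∧_; not)
import Data.Bool.Properties as Bool
open import Data.Fin.Base as Fin using (Fin; zero; suc; toℕ)
import Data.Fin.Properties as Fin
open import Data.Fin.Subset using (Subset; inside; outside; ∣_∣)
open import Data.List.Base as List
  using (List; []; _∷_; _++_; foldr; length; filter; allFin; cartesianProductWith; mapMaybe)
import Data.List.Properties as List
open import Data.List.Relation.Unary.All using (All)
open import Data.Maybe.Base using (Maybe; just; nothing)
open import Data.Nat.Base as ℕ using (ℕ; zero; suc; _∸_)
import Data.Nat.ListAction as ℕ
import Data.Nat.Properties as ℕ
open import Data.Product.Base using (Σ-syntax; ∃; ∃-syntax; _×_; _,_; proj₁; proj₂)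
open import Data.Sum.Base using (_⊎_; inj₁; inj₂; [_,_])
open import Data.Sum.Relation.Binary.Pointwise using (Pointwise; inj₁; inj₂)
open import Data.Unit.Base using (⊤; tt)
open import Data.Vec.Base as Vec using (Vec; []; _∷_; lookup; tabulate)
import Data.Vec.Properties as Vec
open import Function.Base using (_∘_; id; _on_; const)
open import Function.Bundles using (mk⇔)
open import Relation.Binary.Core using (Rel)
open import Relation.Binary.Definitions using (Decidable)
open import Relation.Binary.Structures using (IsEquivalence)
open import Relation.Binary.PropositionalEquality
  using (_≡_; _≢_; refl; sym; trans; cong; cong₂; subst)
open import Relation.Nullary using (Dec; yes; no; does; contradiction)
open import Relation.Nullary.Decidable
  using (map′; recompute; _×-dec_; _→-dec_; dec-true; dec-false)
import Relation.Unary as Unary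

private
  variable
    n : ℕ

------------------------------------------------------------------------
-- Non-crossing partitions

NonCrossing : ∀ {a ℓ₁ ℓ₂} {A : Set a} → Rel A ℓ₁ → Rel A ℓ₂ → Set (a ⊔ ℓ₁ ⊔ ℓ₂)
NonCrossing _<_ _~_ =
  ∀ {a b c d} → a < b → b < c → c < d → a ~ c → b ~ d → a ~ b

-- A set partition of Fin n is encoded by the vector sending every point
-- to the least element of its block, so that equality of partitions is
-- equality of vectors.  The first two conditions say exactly that the
-- fibres of the vector are labelled by their least elements.

record IsNC (v : Vec (Fin n) n) : Set where
  field
    idempotent  : ∀ i → lookup v (lookup v i) ≡ lookup v i
    decreasing  : ∀ i → lookup v i Fin.≤ i
    noncrossing : NonCrossing Fin._<_ (_≡_ on lookup v)

isNC? : (v : Vec (Fin n) n) → Dec (IsNC v)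
isNC? v = map′
  (λ (p , q , r) → record { idempotent = p ; decreasing = q ; noncrossing = r _ _ _ _ })
  (λ p → let open IsNC p in idempotent , decreasing , λ a b c d → noncrossing {a} {b} {c} {d})
  (     Fin.all? (λ i → lookup v (lookup v i) Fin.≟ lookup v i)
  ×-dec Fin.all? (λ i → lookup v i Fin.≤? i)
  ×-dec Fin.all? (λ a → Fin.all? λ b → Fin.all? λ c → Fin.all? λ d →
          (a Fin.<? b) →-dec (b Fin.<? c) →-dec (c Fin.<? d) →-dec
          (lookup v a Fin.≟ lookup v c) →-dec (lookup v b Fin.≟ lookup v d) →-dec
          (lookup v a Fin.≟ lookup v b)))

record NC (n : ℕ) : Set where
  constructor mkNC
  field
    rep    : Vec (Fin n) n
    .valid : IsNC rep

open NC public using (rep)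

isNC : (π : NC n) → IsNC (rep π)
isNC (mkNC v p) = recompute (isNC? v) p

rep-injective : {π σ : NC n} → rep π ≡ rep σ → π ≡ σ
rep-injective refl = refl

_≟_ : Decidable {A = NC n} _≡_
π ≟ σ = map′ rep-injective (cong rep) (Vec.≡-dec Fin._≟_ (rep π) (rep σ))

SameBlock : NC n → Rel (Fin n) 0ℓ
SameBlock π = _≡_ on lookup (rep π)

sameBlock? : (π : NC n) → Decidable (SameBlock π)
sameBlock? π i j = lookup (rep π) i Fin.≟ lookup (rep π) j

block : NC n → Fin n → Subset n
block π i = tabulate λ j → does (sameBlock? π i j)

-- One entry for each block: the fixed points of the vector are the least
-- elements of the blocks.
blocks : NC n → List (Subset n)
blocks {n} π = List.map (block π) (filter (λ i → lookup (rep π) i Fin.≟ i) (allFin n))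

#blocks : NC n → ℕ
#blocks π = length (blocks π)

-- Every block of σ is closed under lying in a common block of π, i.e. is
-- a union of blocks of π.
infix 4 _≤_ _≤?_

_≤_ : Rel (NC n) 0ℓ
π ≤ σ = ∀ i j → SameBlock π i j → SameBlock σ i j

_≤?_ : Decidable (_≤_ {n})
π ≤? σ = Fin.all? λ i → Fin.all? λ j → sameBlock? π i j →-dec sameBlock? σ i j

allVec : ∀ {a} {A : Set a} → List A → (m : ℕ) → List (Vec A m)
allVec xs zero    = [] ∷ []
allVec xs (suc m) = cartesianProductWith _∷_ xs (allVec xs m)

toNC : Vec (Fin n) n → Maybe (NC n)
toNC v with isNC? v
... | yes p = just (mkNC v p)
... | no  _ = nothing

-- All non-crossing partitions of Fin n, each of them once.
allNC : (n : ℕ) → List (NC n)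
allNC n = mapMaybe toNC (allVec (allFin n) n)

------------------------------------------------------------------------
-- The partition given by a non-crossing equivalence relation

private
  least : ∀ {n p} {P : Unary.Pred (Fin n) p} → Unary.Decidable P → ∃ P →
          Σ[ m ∈ Fin n ] P m × (∀ k → P k → m Fin.≤ k)
  least {zero}  P? (() , _)
  least {suc n} P? (i , pi) with P? zero
  ... | yes p0 = zero , p0 , λ _ _ → ℕ.z≤n
  least {suc n} P? (zero  , pi) | no ¬p0 = contradiction pi ¬p0
  least {suc n} P? (suc i , pi) | no ¬p0 with least (P? ∘ suc) (i , pi)
  ... | m , pm , min = suc m , pm , λ
    { zero    p0 → contradiction p0 ¬p0
    ; (suc k) pk → ℕ.s≤s (min k pk)
    }

module FromEquivalence
  {n} {_~_ : Rel (Fin n) 0ℓ} (_~?_ : Decidable _~_) (isEquiv : IsEquivalence _~_)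
  (nc : NonCrossing Fin._<_ _~_)
  where

  private
    module E = IsEquivalence isEquiv

    search : (i : Fin n) → Σ[ m ∈ Fin n ] i ~ m × (∀ k → i ~ k → m Fin.≤ k)
    search i = least (i ~?_) (i , E.refl)

    lab : Fin n → Fin n
    lab i = proj₁ (search i)

    lab~ : ∀ i → i ~ lab i
    lab~ i = proj₁ (proj₂ (search i))

    lab-min : ∀ i k → i ~ k → lab i Fin.≤ k
    lab-min i = proj₂ (proj₂ (search i))

    lab-cong : ∀ {i j} → i ~ j → lab i ≡ lab j
    lab-cong {i} {j} i~j = Fin.≤-antisym
      (lab-min i (lab j) (E.trans i~j (lab~ j)))
      (lab-min j (lab i) (E.trans (E.sym i~j) (lab~ i)))

    lab-reflects : ∀ {i j} → lab i ≡ lab j → i ~ j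
    lab-reflects {i} {j} eq =
      E.trans (lab~ i) (subst (_~ j) (sym eq) (E.sym (lab~ j)))

    look : ∀ i → lookup (tabulate lab) i ≡ lab i
    look = Vec.lookup∘tabulate lab

  reflects : ∀ {i j} → lookup (tabulate lab) i ≡ lookup (tabulate lab) j → i ~ j
  reflects {i} {j} eq = lab-reflects (trans (sym (look i)) (trans eq (look j)))

  preserves : ∀ {i j} → i ~ j → lookup (tabulate lab) i ≡ lookup (tabulate lab) j
  preserves {i} {j} i~j = trans (look i) (trans (lab-cong i~j) (sym (look j)))

  partition : NC n
  partition = mkNC (tabulate lab) (record
    { idempotent  = λ i → preserves (subst (_~ i) (sym (look i)) (E.sym (lab~ i)))
    ; decreasing  = λ i → subst (Fin._≤ i) (sym (look i)) (lab-min i i E.refl)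
    ; noncrossing = λ a<b b<c c<d a~c b~d →
        preserves (nc a<b b<c c<d (reflects a~c) (reflects b~d))
    })

open FromEquivalence using (partition)

-- The partition with one block.  For n = 0 this is the empty partition,
-- the only element of NC 0.
1ₙ : NC n
1ₙ = partition {_~_ = λ _ _ → ⊤} (λ _ _ → yes tt) _ (λ _ _ _ _ _ → tt)

NC-zero : (π : NC 0) → π ≡ 1ₙ
NC-zero (mkNC [] _) = refl

------------------------------------------------------------------------
-- Restriction to a subset

-- The increasing enumeration p₁ < ⋯ < pₘ of a subset.
elements : (W : Subset n) → Fin ∣ W ∣ → Fin n
elements (inside  ∷ W) zero    = zero
elements (inside  ∷ W) (suc i) = suc (elements W i)
elements (outside ∷ W) i       = suc (elements W i)

elements-mono : (W : Subset n) {i j : Fin ∣ W ∣} → i Fin.< j → elements W i Fin.< elements W j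
elements-mono (inside  ∷ W) {zero}  {suc j} _           = ℕ.s≤s ℕ.z≤n
elements-mono (inside  ∷ W) {suc i} {suc j} (ℕ.s≤s i<j) = ℕ.s≤s (elements-mono W i<j)
elements-mono (outside ∷ W) i<j                         = ℕ.s≤s (elements-mono W i<j)

infix 8 _↾_

_↾_ : NC n → (W : Subset n) → NC ∣ W ∣
π ↾ W = partition {_~_ = SameBlock π on elements W}
  (λ i j → sameBlock? π (elements W i) (elements W j))
  (record { refl = refl ; sym = sym ; trans = trans })
  (λ a<b b<c c<d → IsNC.noncrossing (isNC π)
    (elements-mono W a<b) (elements-mono W b<c) (elements-mono W c<d))

------------------------------------------------------------------------
-- The Kreweras complement

-- inj₁ i is the point i and inj₂ i is the point i′; they are ordered as
-- 1 < 1′ < 2 < 2′ < ⋯ < n < n′.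
Points : ℕ → Set
Points n = Fin n ⊎ Fin n

rank : Points n → ℕ
rank = [ (λ i → 2 ℕ.* toℕ i) , (λ i → suc (2 ℕ.* toℕ i)) ]

infix 4 _≺_

_≺_ : Rel (Points n) 0ℓ
_≺_ = ℕ._<_ on rank

Interlaced : NC n → NC n → Set
Interlaced π σ = NonCrossing _≺_ (Pointwise (SameBlock π) (SameBlock σ))

record IsKreweras (π σ : NC n) : Set where
  field
    interlaced : Interlaced π σ
    largest    : ∀ τ → Interlaced π τ → τ ≤ σ

-- Existence of the complement: i′ and j′ lie in the same block iff the
-- points between them form a union of blocks of π.
module Kreweras (π : NC n) where

  below : Fin n → Fin n → Bool
  below i a = does (a Fin.≤? i)

  sep : Fin n → Fin n → Fin n → Bool
  sep i j a = below i a xor below j a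

  _~_ : Rel (Fin n) 0ℓ
  i ~ j = ∀ a b → SameBlock π a b → sep i j a ≡ sep i j b

  _~?_ : Decidable _~_
  i ~? j = Fin.all? λ a → Fin.all? λ b → sameBlock? π a b →-dec (sep i j a Bool.≟ sep i j b)

  xor-cancel : ∀ x y z → (x xor y) xor (y xor z) ≡ x xor z
  xor-cancel false false z     = refl
  xor-cancel false true  false = refl
  xor-cancel false true  true  = refl
  xor-cancel true  false false = refl
  xor-cancel true  false true  = refl
  xor-cancel true  true  z     = refl

  xor-self : ∀ x → x xor x ≡ false
  xor-self false = refl
  xor-self true  = refl

  ~-isEquivalence : IsEquivalence _~_
  ~-isEquivalence = record
    { refl  = λ {i} a b _ → trans (xor-self (below i a)) (sym (xor-self (below i b)))
    ; sym   = λ {i} {j} i~j a b a~b → trans (Bool.xor-comm (below j a) _)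
                (trans (i~j a b a~b) (Bool.xor-comm (below i b) _))
    ; trans = λ {i} {j} {k} i~j j~k a b a~b →
        trans (sym (xor-cancel (below i a) (below j a) (below k a)))
        (trans (cong₂ _xor_ (i~j a b a~b) (j~k a b a~b))
               (xor-cancel (below i b) (below j b) (below k b)))
    }

  below-true : ∀ i a → a Fin.≤ i → below i a ≡ true
  below-true i a = dec-true (a Fin.≤? i)

  below-false : ∀ i a → i Fin.< a → below i a ≡ false
  below-false i a i<a = dec-false (a Fin.≤? i) (ℕ.<⇒≱ i<a)

  Implies : Bool → Bool → Set
  Implies x y = x ≡ true → y ≡ true

  below-cases : ∀ i a → (a Fin.≤ i × below i a ≡ true) ⊎ (i Fin.< a × below i a ≡ false)
  below-cases i a with a Fin.≤? i
  ... | yes a≤i = inj₁ (a≤i , below-true i a a≤i)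
  ... | no  a≰i = inj₂ (ℕ.≰⇒> a≰i , below-false i a (ℕ.≰⇒> a≰i))

  below-mono : ∀ {i j} → i Fin.< j → ∀ a → Implies (below i a) (below j a)
  below-mono {i} {j} i<j a eq with below-cases i a
  ... | inj₁ (a≤i , _) = below-true j a (ℕ.≤-trans a≤i (ℕ.<⇒≤ i<j))
  ... | inj₂ (_ , eq′) with () ← trans (sym eq) eq′

  sep-formula : ∀ x y z w → Implies x y → Implies y z → Implies z w →
                x xor y ≡ (x xor z) ∧ not (y xor w)
  sep-formula false false z     w     _ _ _ with z | w
  ... | false | _     = refl
  ... | true  | true  = refl
  sep-formula false false z w _ _ h | true | false with () ← h refl
  sep-formula false true  true  true  _ _ _ = refl
  sep-formula false true  false w     _ g _ with () ← g refl
  sep-formula false true  true  false _ _ h with () ← h refl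
  sep-formula true  false z     w     f _ _ with () ← f refl
  sep-formula true  true  true  w     _ _ _ = refl
  sep-formula true  true  false w     _ g _ with () ← g refl

  ~-noncrossing : NonCrossing Fin._<_ _~_
  ~-noncrossing {a} {b} {c} {d} a<b b<c c<d a~c b~d x y x~y =
    trans (formula x)
    (trans (cong₂ (λ u v → u ∧ not v) (a~c x y x~y) (b~d x y x~y))
           (sym (formula y)))
    where
    formula : ∀ x → sep a b x ≡ sep a c x ∧ not (sep b d x)
    formula x = sep-formula (below a x) (below b x) (below c x) (below d x)
      (below-mono a<b x) (below-mono b<c x) (below-mono c<d x)

  module K = FromEquivalence _~?_ ~-isEquivalence ~-noncrossing

  ≺₁₁ : (i j : Fin n) → inj₁ i ≺ inj₁ j → i Fin.< j
  ≺₁₁ i j = ℕ.*-cancelˡ-< 2 (toℕ i) (toℕ j)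

  ≺₂₂ : (i j : Fin n) → inj₂ i ≺ inj₂ j → i Fin.< j
  ≺₂₂ i j (ℕ.s≤s p) = ℕ.*-cancelˡ-< 2 (toℕ i) (toℕ j) p

  ≺₁₂ : (i j : Fin n) → inj₁ i ≺ inj₂ j → i Fin.≤ j
  ≺₁₂ i j (ℕ.s≤s p) = ℕ.*-cancelˡ-≤ 2 p

  ≺₂₁ : (i j : Fin n) → inj₂ i ≺ inj₁ j → i Fin.< j
  ≺₂₁ i j p = ℕ.*-cancelˡ-< 2 (toℕ i) (toℕ j) (ℕ.<-trans (ℕ.n<1+n _) p)

  ≤⇒≺ : (i j : Fin n) → i Fin.≤ j → inj₁ i ≺ inj₂ j
  ≤⇒≺ i j p = ℕ.s≤s (ℕ.*-monoʳ-≤ 2 p)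

  <⇒≺ : (i j : Fin n) → i Fin.< j → inj₂ i ≺ inj₁ j
  <⇒≺ i j p = ℕ.≤-trans (ℕ.≤-reflexive (sym (ℕ.*-suc 2 (toℕ i)))) (ℕ.*-monoʳ-≤ 2 p)

  interlaced : Interlaced π K.partition
  interlaced {inj₁ a} {inj₁ b} {inj₁ c} {inj₁ d} a<b b<c c<d (inj₁ a~c) (inj₁ b~d) =
    inj₁ (IsNC.noncrossing (isNC π) (≺₁₁ a b a<b) (≺₁₁ b c b<c) (≺₁₁ c d c<d) a~c b~d)
  interlaced {inj₂ a} {inj₂ b} {inj₂ c} {inj₂ d} a<b b<c c<d (inj₂ a~c) (inj₂ b~d) =
    inj₂ (IsNC.noncrossing (isNC K.partition) (≺₂₂ a b a<b) (≺₂₂ b c b<c) (≺₂₂ c d c<d) a~c b~d)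
  interlaced {inj₁ a} {inj₂ b} {inj₁ c} {inj₂ d} a≺b b≺c c≺d (inj₁ a~c) (inj₂ b~d) =
    contradiction
              (trans (sym (cong₂ _xor_ (below-true b a a≤b) (below-true d a a≤d)))
              (trans (K.reflects b~d a c a~c)
                     (cong₂ _xor_ (below-false b c b<c) (below-true d c c≤d))))
              λ ()
    where
    a≤b = ≺₁₂ a b a≺b
    b<c = ≺₂₁ b c b≺c
    c≤d = ≺₁₂ c d c≺d
    a≤d = ℕ.≤-trans a≤b (ℕ.≤-trans (ℕ.<⇒≤ b<c) c≤d)
  interlaced {inj₂ a} {inj₁ b} {inj₂ c} {inj₁ d} a≺b b≺c c≺d (inj₂ a~c) (inj₁ b~d) =
    contradiction
              (trans (sym (cong₂ _xor_ (below-false a b a<b) (below-true c b b≤c)))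
              (trans (K.reflects a~c b d b~d)
                     (cong₂ _xor_ (below-false a d a<d) (below-false c d c<d))))
              λ ()
    where
    a<b = ≺₂₁ a b a≺b
    b≤c = ≺₁₂ b c b≺c
    c<d = ≺₂₁ c d c≺d
    a<d = ℕ.<-trans (ℕ.<-≤-trans a<b b≤c) c<d

  module _ {τ : NC n} (nc : Interlaced π τ) where

    inside-closed : ∀ i j a b → SameBlock τ i j → SameBlock π a b →
                    i Fin.< a → a Fin.≤ j → i Fin.< b × b Fin.≤ j
    inside-closed i j a b i~j a~b i<a a≤j with b Fin.≤? i | b Fin.≤? j
    ... | yes b≤i | _
      with () ← nc (≤⇒≺ b i b≤i) (<⇒≺ i a i<a) (≤⇒≺ a j a≤j) (inj₁ (sym a~b)) (inj₂ i~j)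
    ... | no  b≰i | yes b≤j = ℕ.≰⇒> b≰i , b≤j
    ... | no  b≰i | no  b≰j
      with () ← nc (<⇒≺ i a i<a) (≤⇒≺ a j a≤j) (<⇒≺ j b (ℕ.≰⇒> b≰j)) (inj₂ i~j) (inj₁ a~b)

    sep-inside : ∀ i j b → i Fin.< b × b Fin.≤ j → sep i j b ≡ true
    sep-inside i j b (i<b , b≤j) = cong₂ _xor_ (below-false i b i<b) (below-true j b b≤j)

    sep-true : ∀ i j a b → SameBlock τ i j → SameBlock π a b →
               sep i j a ≡ true → sep i j b ≡ true
    sep-true i j a b i~j a~b eq with below-cases i a | below-cases j a
    ... | inj₁ (a≤i , _) | inj₂ (j<a , _) =
      trans (Bool.xor-comm (below i b) (below j b))
            (sep-inside j i b (inside-closed j i a b (sym i~j) a~b j<a a≤i))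
    ... | inj₂ (i<a , _) | inj₁ (a≤j , _) =
      sep-inside i j b (inside-closed i j a b i~j a~b i<a a≤j)
    ... | inj₁ (_ , p) | inj₁ (_ , q) with () ← trans (sym eq) (cong₂ _xor_ p q)
    ... | inj₂ (_ , p) | inj₂ (_ , q) with () ← trans (sym eq) (cong₂ _xor_ p q)

    largest : τ ≤ K.partition
    largest i j i~j = K.preserves λ a b a~b → Bool.⇔→≡ {z = true}
      (mk⇔ (sep-true i j a b i~j a~b) (sep-true i j b a i~j (sym a~b)))

  exists : ∃[ σ ] IsKreweras π σ
  exists = K.partition , record { interlaced = interlaced ; largest = λ τ → largest {τ} }

Kr : NC n → NC n
Kr π = proj₁ (Kreweras.exists π)

Kr-isKreweras : (π : NC n) → IsKreweras π (Kr π)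
Kr-isKreweras π = proj₂ (Kreweras.exists π)

------------------------------------------------------------------------
-- Algebras over a commutative ring

-- The ring K of coefficients is arbitrary; the case K = ℂ is the usual one.
module Over {c ℓ} (K : CommutativeRing c ℓ) where

  private
    module K = CommutativeRing K

  record Algebra a ℓa : Set (c ⊔ ℓ ⊔ Level.suc (a ⊔ ℓa)) where
    field
      commutativeRing : CommutativeRing a ℓa
    open CommutativeRing commutativeRing public
    field
      ι      : K.Carrier → Carrier
      ι-homo : RingMorphisms.IsRingHomomorphism K.rawRing rawRing ι

    module ι = RingMorphisms.IsRingHomomorphism ι-homo

    sum : ∀ {x} {X : Set x} → List X → (X → Carrier) → Carrier
    sum xs f = foldr (λ x → f x +_) 0# xs

    product : ∀ {x} {X : Set x} → List X → (X → Carrier) → Carrier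
    product xs f = foldr (λ x → f x *_) 1# xs

  record IsAlgebraHom {a ℓa b ℓb} (A : Algebra a ℓa) (B : Algebra b ℓb)
         (f : Algebra.Carrier A → Algebra.Carrier B) : Set (c ⊔ a ⊔ ℓa ⊔ ℓb) where
    private
      module A = Algebra A
      module B = Algebra B
    field
      isRingHomomorphism : RingMorphisms.IsRingHomomorphism A.rawRing B.rawRing f
      ι-commutes         : ∀ k → f (A.ι k) B.≈ B.ι k

  ground : Algebra c ℓ
  ground = record
    { commutativeRing = K
    ; ι      = id
    ; ι-homo = record
      { isSemiringHomomorphism = record
        { isNearSemiringHomomorphism = record
          { +-isMonoidHomomorphism = record
            { isMagmaHomomorphism = record
              { isRelHomomorphism = record { cong = id }
              ; homo = λ _ _ → K.refl
              }
            ; ε-homo = K.refl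
            }
          ; *-homo = λ _ _ → K.refl
          }
        ; 1#-homo = K.refl
        }
      ; -‿homo = λ _ → K.refl
      }
    }

  ----------------------------------------------------------------------
  -- Polynomial algebras

  -- K[ I ] is the free commutative K-algebra on I: polynomial expressions
  -- in the variables I modulo the congruence generated by the axioms of
  -- commutative K-algebras.

  module Polynomial (I : Set) where

    infixl 6 _:+_
    infixl 7 _:*_
    infix  4 _∼_

    data Poly : Set c where
      con       : K.Carrier → Poly
      var       : I → Poly
      _:+_ _:*_ : Poly → Poly → Poly

    data _∼_ : Rel Poly (c ⊔ ℓ) where
      ∼-refl      : ∀ {p} → p ∼ p
      ∼-sym       : ∀ {p q} → p ∼ q → q ∼ p
      ∼-trans     : ∀ {p q r} → p ∼ q → q ∼ r → p ∼ r
      +-cong      : ∀ {p p′ q q′} → p ∼ p′ → q ∼ q′ → p :+ q ∼ p′ :+ q′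
      *-cong      : ∀ {p p′ q q′} → p ∼ p′ → q ∼ q′ → p :* q ∼ p′ :* q′
      +-assoc     : ∀ p q r → (p :+ q) :+ r ∼ p :+ (q :+ r)
      +-comm      : ∀ p q → p :+ q ∼ q :+ p
      +-identityˡ : ∀ p → con K.0# :+ p ∼ p
      *-assoc     : ∀ p q r → (p :* q) :* r ∼ p :* (q :* r)
      *-comm      : ∀ p q → p :* q ∼ q :* p
      *-identityˡ : ∀ p → con K.1# :* p ∼ p
      zeroˡ       : ∀ p → con K.0# :* p ∼ con K.0#
      distribˡ    : ∀ p q r → p :* (q :+ r) ∼ p :* q :+ p :* r
      con-cong    : ∀ {k l} → k K.≈ l → con k ∼ con l
      con-+       : ∀ k l → con (k K.+ l) ∼ con k :+ con l
      con-*       : ∀ k l → con (k K.* l) ∼ con k :* con l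

    :-_ : Poly → Poly
    :- p = con (K.- K.1#) :* p

    private
      infixr 4 _∙_
      _∙_ : ∀ {p q r} → p ∼ q → q ∼ r → p ∼ r
      _∙_ = ∼-trans

      +-identityʳ : ∀ p → p :+ con K.0# ∼ p
      +-identityʳ p = +-comm _ _ ∙ +-identityˡ p

      distribʳ : ∀ p q r → (q :+ r) :* p ∼ q :* p :+ r :* p
      distribʳ p q r = *-comm _ _ ∙ distribˡ p q r ∙ +-cong (*-comm _ _) (*-comm _ _)

      inverseˡ : ∀ p → :- p :+ p ∼ con K.0#
      inverseˡ p = +-cong ∼-refl (∼-sym (*-identityˡ p))
                 ∙ ∼-sym (distribʳ p _ _)
                 ∙ *-cong (∼-sym (con-+ _ _) ∙ con-cong (K.-‿inverseˡ K.1#)) ∼-refl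
                 ∙ zeroˡ p

      con-neg : ∀ k → con (K.- k) ∼ :- con k
      con-neg k = con-cong (K.sym (-1*x≈-x k)) ∙ con-* _ _
        where open import Algebra.Properties.Ring K.ring using (-1*x≈-x)

    polyRing : CommutativeRing c (c ⊔ ℓ)
    polyRing = record
      { Carrier = Poly ; _≈_ = _∼_ ; _+_ = _:+_ ; _*_ = _:*_
      ; -_ = :-_ ; 0# = con K.0# ; 1# = con K.1#
      ; isCommutativeRing = record
        { isRing = record
          { +-isAbelianGroup = record
            { isGroup = record
              { isMonoid = record
                { isSemigroup = record
                  { isMagma = record
                    { isEquivalence = record { refl = ∼-refl ; sym = ∼-sym ; trans = ∼-trans }
                    ; ∙-cong = +-cong
                    }
                  ; assoc = +-assoc
                  }
                ; identity = +-identityˡ , +-identityʳ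
                }
              ; inverse = inverseˡ , λ p → +-comm _ _ ∙ inverseˡ p
              ; ⁻¹-cong = *-cong ∼-refl
              }
            ; comm = +-comm
            }
          ; *-cong = *-cong
          ; *-assoc = *-assoc
          ; *-identity = *-identityˡ , λ p → *-comm _ _ ∙ *-identityˡ p
          ; distrib = distribˡ , distribʳ
          }
        ; *-comm = *-comm
        }
      }

    algebra : Algebra c (c ⊔ ℓ)
    algebra = record
      { commutativeRing = polyRing
      ; ι      = con
      ; ι-homo = record
        { isSemiringHomomorphism = record
          { isNearSemiringHomomorphism = record
            { +-isMonoidHomomorphism = record
              { isMagmaHomomorphism = record
                { isRelHomomorphism = record { cong = con-cong }
                ; homo = con-+
                }
              ; ε-homo = ∼-refl
              }
            ; *-homo = con-*
            }
          ; 1#-homo = ∼-refl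
          }
        ; -‿homo = con-neg
        }
      }

    -- The unital algebra homomorphism determined by its values on the
    -- variables.
    module _ {b ℓb} (B : Algebra b ℓb) where

      private
        module B = Algebra B

      eval : (I → B.Carrier) → Poly → B.Carrier
      eval f (con k)  = B.ι k
      eval f (var i)  = f i
      eval f (p :+ q) = eval f p B.+ eval f q
      eval f (p :* q) = eval f p B.* eval f q

      eval-cong : ∀ f {p q} → p ∼ q → eval f p B.≈ eval f q
      eval-cong f ∼-refl            = B.refl
      eval-cong f (∼-sym e)         = B.sym (eval-cong f e)
      eval-cong f (∼-trans e e′)    = B.trans (eval-cong f e) (eval-cong f e′)
      eval-cong f (+-cong e e′)     = B.+-cong (eval-cong f e) (eval-cong f e′)
      eval-cong f (*-cong e e′)     = B.*-cong (eval-cong f e) (eval-cong f e′)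
      eval-cong f (+-assoc p q r)   = B.+-assoc _ _ _
      eval-cong f (+-comm p q)      = B.+-comm _ _
      eval-cong f (+-identityˡ p)   = B.trans (B.+-congʳ B.ι.0#-homo) (B.+-identityˡ _)
      eval-cong f (*-assoc p q r)   = B.*-assoc _ _ _
      eval-cong f (*-comm p q)      = B.*-comm _ _
      eval-cong f (*-identityˡ p)   = B.trans (B.*-congʳ B.ι.1#-homo) (B.*-identityˡ _)
      eval-cong f (zeroˡ p)         =
        B.trans (B.*-congʳ B.ι.0#-homo) (B.trans (B.zeroˡ _) (B.sym B.ι.0#-homo))
      eval-cong f (distribˡ p q r)  = B.distribˡ _ _ _
      eval-cong f (con-cong e)      = B.ι.⟦⟧-cong e
      eval-cong f (con-+ k l)       = B.ι.+-homo k l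
      eval-cong f (con-* k l)       = B.ι.*-homo k l

      eval-isAlgebraHom : ∀ f → IsAlgebraHom algebra B (eval f)
      eval-isAlgebraHom f = record
        { isRingHomomorphism = record
          { isSemiringHomomorphism = record
            { isNearSemiringHomomorphism = record
              { +-isMonoidHomomorphism = record
                { isMagmaHomomorphism = record
                  { isRelHomomorphism = record { cong = eval-cong f }
                  ; homo = λ _ _ → B.refl
                  }
                ; ε-homo = B.ι.0#-homo
                }
              ; *-homo = λ _ _ → B.refl
              }
            ; 1#-homo = B.ι.1#-homo
            }
          ; -‿homo = λ p → B.trans
              (B.*-congʳ (B.trans (B.ι.-‿homo K.1#) (B.-‿cong B.ι.1#-homo)))
              (-1*x≈-x (eval f p))
          }
        ; ι-commutes = λ _ → B.refl
        }
        where open import Algebra.Properties.Ring B.ring using (-1*x≈-x)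

      eval-unique : ∀ f g → IsAlgebraHom algebra B g → (∀ i → g (var i) B.≈ f i) →
                    ∀ p → g p B.≈ eval f p
      eval-unique f g g-hom g-var = go
        where
        open IsAlgebraHom g-hom
        open RingMorphisms.IsRingHomomorphism isRingHomomorphism
        go : ∀ p → g p B.≈ eval f p
        go (con k)  = ι-commutes k
        go (var i)  = g-var i
        go (p :+ q) = B.trans (+-homo p q) (B.+-cong (go p) (go q))
        go (p :* q) = B.trans (*-homo p q) (B.*-cong (go p) (go q))

    monomial : List I → Poly
    monomial is = Algebra.product algebra is var

    -- The homogeneous component of degree d, for the grading in which the
    -- variable i has degree deg i: the linear combinations of monomials of
    -- degree d.
    Homogeneous : (I → ℕ) → ℕ → Poly → Set (c ⊔ ℓ)
    Homogeneous deg d p = Σ[ ts ∈ List (K.Carrier × List I) ]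
      All (λ (k , is) → ℕ.sum (List.map deg is) ≡ d) ts ×
      p ∼ Algebra.sum algebra ts (λ (k , is) → con k :* monomial is)

  ----------------------------------------------------------------------
  -- Tensor products of algebras

  -- A list of pairs (a , b) stands for the sum of the pure tensors a ⊗ b,
  -- and _∼_ is the congruence generated by the bilinearity relations.

  module Tensor {a ℓa b ℓb} (A : Algebra a ℓa) (B : Algebra b ℓb) where

    private
      module A = Algebra A
      module B = Algebra B

    Pure : Set (a ⊔ b)
    Pure = A.Carrier × B.Carrier

    infix 4 _∼_

    data _∼_ : Rel (List Pure) (c ⊔ a ⊔ ℓa ⊔ b ⊔ ℓb) where
      ∼-refl   : ∀ {u} → u ∼ u
      ∼-sym    : ∀ {u v} → u ∼ v → v ∼ u
      ∼-trans  : ∀ {u v w} → u ∼ v → v ∼ w → u ∼ w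
      ++-cong  : ∀ {u u′ v v′} → u ∼ u′ → v ∼ v′ → u ++ v ∼ u′ ++ v′
      ++-comm  : ∀ u v → u ++ v ∼ v ++ u
      ⊗-cong   : ∀ {x x′ y y′} → x A.≈ x′ → y B.≈ y′ → (x , y) ∷ [] ∼ (x′ , y′) ∷ []
      +-⊗      : ∀ x x′ y → (x A.+ x′ , y) ∷ [] ∼ (x , y) ∷ (x′ , y) ∷ []
      ⊗-+      : ∀ x y y′ → (x , y B.+ y′) ∷ [] ∼ (x , y) ∷ (x , y′) ∷ []
      0-⊗      : ∀ y → (A.0# , y) ∷ [] ∼ []
      balanced : ∀ k x y → (A.ι k A.* x , y) ∷ [] ∼ (x , B.ι k B.* y) ∷ []

    infixr 7 _⊗_
    infixl 7 _:*_

    _⊗_ : A.Carrier → B.Carrier → List Pure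
    x ⊗ y = (x , y) ∷ []

    _·_ : Pure → Pure → Pure
    (x , y) · (x′ , y′) = x A.* x′ , y B.* y′

    _:*_ : List Pure → List Pure → List Pure
    _:*_ = cartesianProductWith _·_

    :-_ : List Pure → List Pure
    :-_ = List.map λ (x , y) → A.- x , y

    private
      infixr 4 _∙_
      _∙_ : ∀ {u v w} → u ∼ v → v ∼ w → u ∼ w
      _∙_ = ∼-trans

      ≡⇒∼ : ∀ {u v} → u ≡ v → u ∼ v
      ≡⇒∼ refl = ∼-refl

      ++-assoc : ∀ u v w → (u ++ v) ++ w ∼ u ++ (v ++ w)
      ++-assoc u v w = ≡⇒∼ (List.++-assoc u v w)

      interchange : ∀ s t u v → (s ++ t) ++ (u ++ v) ∼ (s ++ u) ++ (t ++ v)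
      interchange s t u v =
          ++-assoc s t (u ++ v)
        ∙ ++-cong {u = s} ∼-refl (∼-sym (++-assoc t u v) ∙ ++-cong (++-comm t u) ∼-refl ∙ ++-assoc u t v)
        ∙ ∼-sym (++-assoc s u (t ++ v))

      map-pointwise : (f g : Pure → Pure) → (∀ p → f p ∷ [] ∼ g p ∷ []) →
                      ∀ u → List.map f u ∼ List.map g u
      map-pointwise f g h []      = ∼-refl
      map-pointwise f g h (p ∷ u) = ++-cong (h p) (map-pointwise f g h u)

      swapᴬ : ∀ x y z → x A.* (y A.* z) A.≈ y A.* (x A.* z)
      swapᴬ x y z =
        A.trans (A.sym (A.*-assoc x y z)) (A.trans (A.*-congʳ (A.*-comm x y)) (A.*-assoc y x z))

      swapᴮ : ∀ x y z → x B.* (y B.* z) B.≈ y B.* (x B.* z)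
      swapᴮ x y z =
        B.trans (B.sym (B.*-assoc x y z)) (B.trans (B.*-congʳ (B.*-comm x y)) (B.*-assoc y x z))

      ·-cong : ∀ p {u v} → u ∼ v → List.map (p ·_) u ∼ List.map (p ·_) v
      ·-cong p ∼-refl        = ∼-refl
      ·-cong p (∼-sym e)     = ∼-sym (·-cong p e)
      ·-cong p (∼-trans e f) = ·-cong p e ∙ ·-cong p f
      ·-cong p (++-cong {u} {u′} {v} {v′} e f) =
        ≡⇒∼ (List.map-++ (p ·_) u v) ∙ ++-cong (·-cong p e) (·-cong p f)
        ∙ ≡⇒∼ (sym (List.map-++ (p ·_) u′ v′))
      ·-cong p (++-comm u v) =
        ≡⇒∼ (List.map-++ (p ·_) u v) ∙ ++-comm (List.map (p ·_) u) (List.map (p ·_) v)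
        ∙ ≡⇒∼ (sym (List.map-++ (p ·_) v u))
      ·-cong p (⊗-cong e f)  = ⊗-cong (A.*-congˡ e) (B.*-congˡ f)
      ·-cong p (+-⊗ x x′ y)  = ⊗-cong (A.distribˡ _ _ _) B.refl ∙ +-⊗ _ _ _
      ·-cong p (⊗-+ x y y′)  = ⊗-cong A.refl (B.distribˡ _ _ _) ∙ ⊗-+ _ _ _
      ·-cong p (0-⊗ y)       = ⊗-cong (A.zeroʳ _) B.refl ∙ 0-⊗ _
      ·-cong (r , s) (balanced k x y) =
        ⊗-cong (swapᴬ r (A.ι k) x) B.refl ∙ balanced k _ _ ∙ ⊗-cong A.refl (swapᴮ (B.ι k) s y)

      *-congˡ : ∀ u {v w} → v ∼ w → u :* v ∼ u :* w
      *-congˡ []      e = ∼-refl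
      *-congˡ (p ∷ u) e = ++-cong (·-cong p e) (*-congˡ u e)

      *-∷ : ∀ p u v → v :* (p ∷ u) ∼ List.map (p ·_) v ++ v :* u
      *-∷ p u []      = ∼-refl
      *-∷ p u (q ∷ v) =
          ++-cong {u = q · p ∷ List.map (q ·_) u} {u′ = p · q ∷ List.map (q ·_) u}
            (++-cong {u = q · p ∷ []} {u′ = p · q ∷ []}
              (⊗-cong (A.*-comm _ _) (B.*-comm _ _)) ∼-refl)
            (*-∷ p u v)
        ∙ interchange (p · q ∷ []) (List.map (q ·_) u) (List.map (p ·_) v) (v :* u)

      zeroʳ : ∀ u → u :* [] ≡ []
      zeroʳ []      = refl
      zeroʳ (p ∷ u) = zeroʳ u

      *-comm : ∀ u v → u :* v ∼ v :* u
      *-comm []      v = ≡⇒∼ (sym (zeroʳ v))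
      *-comm (p ∷ u) v = ++-cong ∼-refl (*-comm u v) ∙ ∼-sym (*-∷ p u v)

      *-cong : ∀ {u u′ v v′} → u ∼ u′ → v ∼ v′ → u :* v ∼ u′ :* v′
      *-cong {u} {u′} {v} {v′} e f =
        *-congˡ u f ∙ *-comm u v′ ∙ *-congˡ v′ e ∙ *-comm v′ u′

      distribʳ : ∀ w u v → (u ++ v) :* w ∼ u :* w ++ v :* w
      distribʳ w []      v = ∼-refl
      distribʳ w (p ∷ u) v =
        ++-cong ∼-refl (distribʳ w u v) ∙ ∼-sym (++-assoc (List.map (p ·_) w) (u :* w) (v :* w))

      distribˡ : ∀ w u v → w :* (u ++ v) ∼ w :* u ++ w :* v
      distribˡ w u v =
        *-comm w (u ++ v) ∙ distribʳ w u v ∙ ++-cong (*-comm u w) (*-comm v w)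

      ·-assoc : ∀ p q u → List.map ((p · q) ·_) u ∼ List.map (p ·_) (List.map (q ·_) u)
      ·-assoc p q u =
          map-pointwise ((p · q) ·_) (λ r → p · (q · r))
            (λ r → ⊗-cong (A.*-assoc _ _ _) (B.*-assoc _ _ _)) u
        ∙ ≡⇒∼ (List.map-∘ u)

      ·-* : ∀ p u v → List.map (p ·_) u :* v ∼ List.map (p ·_) (u :* v)
      ·-* p []      v = ∼-refl
      ·-* p (q ∷ u) v =
          ++-cong (·-assoc p q v) (·-* p u v)
        ∙ ≡⇒∼ (sym (List.map-++ (p ·_) (List.map (q ·_) v) (u :* v)))

      *-assoc : ∀ u v w → (u :* v) :* w ∼ u :* (v :* w)
      *-assoc []      v w = ∼-refl
      *-assoc (p ∷ u) v w =
        distribʳ w (List.map (p ·_) v) (u :* v) ∙ ++-cong (·-* p v w) (*-assoc u v w)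

      *-identityˡ : ∀ u → (A.1# ⊗ B.1#) :* u ∼ u
      *-identityˡ u =
          ≡⇒∼ (List.++-identityʳ _)
        ∙ map-pointwise _ id (λ _ → ⊗-cong (A.*-identityˡ _) (B.*-identityˡ _)) u
        ∙ ≡⇒∼ (List.map-id u)

      -1·x≈-x : ∀ u → List.map ((A.- A.1# , B.1#) ·_) u ∼ :- u
      -1·x≈-x = map-pointwise _ _ λ _ → ⊗-cong (-1*x≈-x _) (B.*-identityˡ _)
        where open import Algebra.Properties.Ring A.ring using (-1*x≈-x)

      neg-cong : ∀ {u v} → u ∼ v → :- u ∼ :- v
      neg-cong {u} {v} e = ∼-sym (-1·x≈-x u) ∙ ·-cong _ e ∙ -1·x≈-x v

      inverseˡ : ∀ u → :- u ++ u ∼ []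
      inverseˡ []            = ∼-refl
      inverseˡ ((x , y) ∷ u) =
          interchange ((A.- x) ⊗ y) (:- u) (x ⊗ y) u
        ∙ ++-cong (∼-sym (+-⊗ _ _ _) ∙ ⊗-cong (A.-‿inverseˡ x) B.refl ∙ 0-⊗ y) (inverseˡ u)

    algebra : Algebra (a ⊔ b) (c ⊔ a ⊔ ℓa ⊔ b ⊔ ℓb)
    algebra = record
      { commutativeRing = record
        { Carrier = List Pure ; _≈_ = _∼_ ; _+_ = _++_ ; _*_ = _:*_
        ; -_ = :-_ ; 0# = [] ; 1# = A.1# ⊗ B.1#
        ; isCommutativeRing = record
          { isRing = record
            { +-isAbelianGroup = record
              { isGroup = record
                { isMonoid = record
                  { isSemigroup = record
                    { isMagma = record
                      { isEquivalence = record { refl = ∼-refl ; sym = ∼-sym ; trans = ∼-trans }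
                      ; ∙-cong = ++-cong
                      }
                    ; assoc = ++-assoc
                    }
                  ; identity = (λ _ → ∼-refl) , λ u → ≡⇒∼ (List.++-identityʳ u)
                  }
                ; inverse = inverseˡ , λ u → ++-comm u (:- u) ∙ inverseˡ u
                ; ⁻¹-cong = neg-cong
                }
              ; comm = ++-comm
              }
            ; *-cong = *-cong
            ; *-assoc = *-assoc
            ; *-identity = *-identityˡ , λ u → *-comm u _ ∙ *-identityˡ u
            ; distrib = distribˡ , distribʳ
            }
          ; *-comm = *-comm
          }
        }
      ; ι      = λ k → A.ι k ⊗ B.1#
      ; ι-homo = record
        { isSemiringHomomorphism = record
          { isNearSemiringHomomorphism = record
            { +-isMonoidHomomorphism = record
              { isMagmaHomomorphism = record
                { isRelHomomorphism = record { cong = λ e → ⊗-cong (A.ι.⟦⟧-cong e) B.refl }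
                ; homo = λ k l → ⊗-cong (A.ι.+-homo k l) B.refl ∙ +-⊗ _ _ _
                }
              ; ε-homo = ⊗-cong A.ι.0#-homo B.refl ∙ 0-⊗ _
              }
            ; *-homo = λ k l → ⊗-cong (A.ι.*-homo k l) (B.sym (B.*-identityˡ _))
            }
          ; 1#-homo = ⊗-cong A.ι.1#-homo B.refl
          }
        ; -‿homo = λ k → ⊗-cong (A.ι.-‿homo k) B.refl
        }
      }

  infixr 7 _⊗_

  _⊗_ : ∀ {a ℓa b ℓb} → Algebra a ℓa → Algebra b ℓb → Algebra (a ⊔ b) (c ⊔ a ⊔ ℓa ⊔ b ⊔ ℓb)
  A ⊗ B = Tensor.algebra A B

  _⊗ₕ_ : ∀ {a a′ b b′} {A : Set a} {A′ : Set a′} {B : Set b} {B′ : Set b′} →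
         (A → A′) → (B → B′) → List (A × B) → List (A′ × B′)
  f ⊗ₕ g = List.map λ (x , y) → f x , g y

  ----------------------------------------------------------------------
  -- Graded bialgebras and their homomorphisms

  -- The structure of a graded bialgebra without its axioms, to which the
  -- notion of a homomorphism does not refer.
  record RawGradedBialgebra a ℓa h : Set (c ⊔ ℓ ⊔ Level.suc (a ⊔ ℓa ⊔ h)) where
    field
      algebra     : Algebra a ℓa
    open Algebra algebra public
    field
      Δ           : Carrier → Algebra.Carrier (algebra ⊗ algebra)
      ε           : Carrier → K.Carrier
      Homogeneous : ℕ → Carrier → Set h

  record IsGradedBialgebraHom {a ℓa h b ℓb h′}
         (A : RawGradedBialgebra a ℓa h) (B : RawGradedBialgebra b ℓb h′)
         (f : RawGradedBialgebra.Carrier A → RawGradedBialgebra.Carrier B) :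
         Set (c ⊔ ℓ ⊔ a ⊔ ℓa ⊔ h ⊔ b ⊔ ℓb ⊔ h′) where
    private
      module A = RawGradedBialgebra A
      module B = RawGradedBialgebra B
    field
      isAlgebraHom : IsAlgebraHom A.algebra B.algebra f
      Δ-commutes   : ∀ x → Algebra._≈_ (B.algebra ⊗ B.algebra) (B.Δ (f x)) ((f ⊗ₕ f) (A.Δ x))
      ε-commutes   : ∀ x → B.ε (f x) K.≈ A.ε x
      graded       : ∀ d x → A.Homogeneous d x → B.Homogeneous d (f x)

  ----------------------------------------------------------------------
  -- The bialgebra 𝒯

  -- NC 0 contributes no variable, by NC-zero.
  record Var𝒯 : Set where
    constructor mkVar
    field
      {size}  : ℕ
      part    : NC size
      .proper : part ≢ 1ₙ

  module P𝒯 = Polynomial Var𝒯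

  𝒯-algebra : Algebra c (c ⊔ ℓ)
  𝒯-algebra = P𝒯.algebra

  X : NC n → Algebra.Carrier 𝒯-algebra
  X π with π ≟ 1ₙ
  ... | yes _   = Algebra.1# 𝒯-algebra
  ... | no π≢1ₙ = P𝒯.var (mkVar π π≢1ₙ)

  Δ-X : NC n → Algebra.Carrier (𝒯-algebra ⊗ 𝒯-algebra)
  Δ-X {n} π = sum (filter (π ≤?_) (allNC n)) λ σ →
      Algebra.product 𝒯-algebra (blocks σ) (λ W → X (π ↾ W)) ⊗ᵗ X σ
    where
    open Algebra (𝒯-algebra ⊗ 𝒯-algebra) using (sum)
    open Tensor 𝒯-algebra 𝒯-algebra using () renaming (_⊗_ to _⊗ᵗ_)

  𝒯 : RawGradedBialgebra c (c ⊔ ℓ) (c ⊔ ℓ)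
  𝒯 = record
    { algebra     = 𝒯-algebra
    ; Δ           = P𝒯.eval (𝒯-algebra ⊗ 𝒯-algebra) (Δ-X ∘ Var𝒯.part)
    ; ε           = P𝒯.eval ground (const K.0#)
    ; Homogeneous = P𝒯.Homogeneous λ v → #blocks (Var𝒯.part v) ∸ 1
    }

  ----------------------------------------------------------------------
  -- The bialgebra Sym

  -- The variable k is Y₂₊ₖ.
  module PSym = Polynomial ℕ

  Sym-algebra : Algebra c (c ⊔ ℓ)
  Sym-algebra = PSym.algebra

  -- The value at 0 is a dummy: blocks are non-empty.
  Y : ℕ → Algebra.Carrier Sym-algebra
  Y 0             = Algebra.1# Sym-algebra
  Y 1             = Algebra.1# Sym-algebra
  Y (suc (suc k)) = PSym.var k

  Yₚ : NC n → Algebra.Carrier Sym-algebra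
  Yₚ π = Algebra.product Sym-algebra (blocks π) (λ V → Y ∣ V ∣)

  Δ-Y : ℕ → Algebra.Carrier (Sym-algebra ⊗ Sym-algebra)
  Δ-Y n = sum (allNC n) λ π → Yₚ π ⊗ᵗ Yₚ (Kr π)
    where
    open Algebra (Sym-algebra ⊗ Sym-algebra) using (sum)
    open Tensor Sym-algebra Sym-algebra using () renaming (_⊗_ to _⊗ᵗ_)

  Sym : RawGradedBialgebra c (c ⊔ ℓ) (c ⊔ ℓ)
  Sym = record
    { algebra     = Sym-algebra
    ; Δ           = PSym.eval (Sym-algebra ⊗ Sym-algebra) (λ k → Δ-Y (2 ℕ.+ k))
    ; ε           = PSym.eval ground (const K.0#)
    ; Homogeneous = PSym.Homogeneous suc
    }

  Ψ : RawGradedBialgebra.Carrier 𝒯 → RawGradedBialgebra.Carrier Sym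
  Ψ = P𝒯.eval Sym-algebra (λ v → Yₚ (Kr (Var𝒯.part v)))

{-
Write κ = Kr(π).  The map Kr is an order-reversing bijection of NC(n): its
inverse is the adjoint in the Galois connection "no pair in a block of σ
separates a pair in a block of π".  The multiplicativity of Δ on Sym gives,
after reindexing each Δ(Y_{|V|}) by the inverse of Kr,

  Δ(Y_κ) = Σ_{τ ≤ κ} (Π_{V ∈ κ} Y_{Kr⁻¹(τ_V)}) ⊗ Y_τ,

because a partition τ ≤ κ is a choice of a partition of every block of κ.
Substituting τ = Kr(σ) turns the sum into one over σ ≥ π, and it remains to
see that the partitions Kr⁻¹(τ_V), V ∈ κ, glue to the same partition ρ ≤ κ
as the partitions Kr(π_W), W ∈ σ.  The gradings and counits match because i
is not the last point of its block of κ exactly if i + 1 is the first point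
of its block of π, whence Σ_{V ∈ κ} (|V| − 1) = |π| − 1.

Several equalities of partitions are shown by proving one inequality and
that the coarser partition has no new non-minimal (or non-maximal) point.
-}

module Submission where

open import Defs
open import Algebra.Bundles using (CommutativeMonoid; CommutativeRing; CommutativeSemiring)
open import Data.Bool.Base using (Bool; true; false; not; if_then_else_; _xor_)
import Data.Bool.Properties as Bool
open import Data.Empty using (⊥)
open import Data.Empty.Irrelevant using () renaming (⊥-elim to ⊥-irr)
open import Data.Fin.Base as Fin using (Fin; zero; suc; toℕ)
import Data.Fin.Properties as Fin
open import Data.Fin.Subset using (Subset; ∣_∣)
open import Data.List.Base as List
  using (List; []; _∷_; _++_; length; foldr; filter; allFin; cartesianProductWith; mapMaybe)
open import Data.List.Membership.Propositional using (_∈_)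
open import Data.List.Membership.Propositional.Properties
  using (∈-allFin; ∈-map⁺; ∈-map⁻; ∈-filter⁺; ∈-filter⁻; ∈-cartesianProductWith⁺)
open import Data.List.Membership.Propositional.Properties.WithK using (unique∧set⇒bag)
import Data.List.Properties as List
open import Data.List.Relation.Binary.BagAndSetEquality using (∼bag⇒↭)
open import Data.List.Relation.Binary.Permutation.Propositional using (_↭_)
open import Data.List.Relation.Unary.All as All using (All; []; _∷_)
import Data.List.Relation.Unary.All.Properties as All
open import Data.List.Relation.Unary.AllPairs using ([]; _∷_)
open import Data.List.Relation.Unary.Any using (here; there)
open import Data.List.Relation.Unary.Unique.Propositional using (Unique)
import Data.List.Relation.Unary.Unique.Propositional.Properties as Unique
open import Data.Maybe.Base using (Maybe; just; nothing)
open import Data.Nat.Base as ℕ using (ℕ; NonZero; zero; suc; _∸_; z≤n; s≤s)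
import Data.Nat.ListAction as ℕ
import Data.Nat.ListAction.Properties as ℕ
import Data.Nat.Properties as ℕ
open import Data.Product.Base using (∃; ∃-syntax; _×_; _,_; proj₁; proj₂)
open import Data.Sum.Base using (_⊎_; inj₁; inj₂)
open import Data.Unit.Base using (⊤; tt)
open import Data.Vec.Base using (Vec; []; _∷_; lookup)
import Data.Vec.Properties as Vec
open import Function.Base using (_∘_; id; case_of_)
open import Function.Bundles using (mk⇔)
open import Relation.Binary.Structures using (IsEquivalence)
open import Relation.Binary.Definitions using (tri<; tri≈; tri>)
open import Relation.Binary.PropositionalEquality
  using (_≡_; _≢_; refl; sym; trans; cong; cong₂; subst; subst₂)
open import Relation.Nullary using (¬_; Dec; yes; no; does; contradiction)
open import Relation.Nullary.Decidable using (does-⇔; ¬?; dec-true; dec-false; _→-dec_; _×-dec_)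
import Relation.Unary as Unary

private
  variable
    n : ℕ

-- Extensionality of vectors and neighbours in finite chains.

lookup-ext : ∀ {a} {A : Set a} {u v : Vec A n} → (∀ i → lookup u i ≡ lookup v i) → u ≡ v
lookup-ext {u = u} {v} eq =
  trans (sym (Vec.tabulate∘lookup u)) (trans (Vec.tabulate-cong eq) (Vec.tabulate∘lookup v))

greatest : ∀ {p} {P : Unary.Pred (Fin n) p} → Unary.Decidable P → ∃ P →
           ∃[ m ] P m × (∀ k → P k → k Fin.≤ m)
greatest {suc n} P? (i , pi) with Fin.any? (P? ∘ suc)
... | yes ∃p with greatest (P? ∘ suc) ∃p
... | m , pm , max = suc m , pm , λ { zero _ → z≤n ; (suc k) pk → s≤s (max k pk) }
greatest {suc n} P? (zero  , pi) | no ∄p = zero , pi , λ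
  { zero _ → z≤n ; (suc k) pk → contradiction (k , pk) ∄p }
greatest {suc n} P? (suc i , pi) | no ∄p = contradiction (i , pi) ∄p

predecessor : (j u : Fin n) → j Fin.< u → ∃[ p ] suc (toℕ {n} p) ≡ toℕ u
predecessor j (suc u) _ = Fin.inject₁ u , cong suc (Fin.toℕ-inject₁ u)

successor : (i j : Fin n) → i Fin.< j → ∃[ q ] toℕ {n} q ≡ suc (toℕ i)
successor i j i<j = Fin.fromℕ< (ℕ.≤-<-trans i<j (Fin.toℕ<n j)) , Fin.toℕ-fromℕ< _

-- Extreme elements of blocks

module _ (π : NC n) where

  open IsNC (isNC π)

  min : Fin n → Fin n
  min = lookup (rep π)

  min-same : ∀ i → SameBlock π (min i) i
  min-same = idempotent

  min-least : ∀ {i j} → SameBlock π i j → min i Fin.≤ j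
  min-least {i} {j} i~j = subst (Fin._≤ j) (sym i~j) (decreasing j)

  private
    last-of-block : ∀ i → ∃[ m ] SameBlock π i m × (∀ k → SameBlock π i k → k Fin.≤ m)
    last-of-block i = greatest (sameBlock? π i) (i , refl)

  max : Fin n → Fin n
  max i = proj₁ (last-of-block i)

  max-same : ∀ i → SameBlock π i (max i)
  max-same i = proj₁ (proj₂ (last-of-block i))

  max-greatest : ∀ {i j} → SameBlock π i j → j Fin.≤ max i
  max-greatest {i} {j} = proj₂ (proj₂ (last-of-block i)) j

  max-cong : ∀ {i j} → SameBlock π i j → max i ≡ max j
  max-cong {i} {j} i~j = Fin.≤-antisym
    (max-greatest (trans (sym i~j) (max-same i)))
    (max-greatest (trans i~j (max-same j)))

  min⁺ : ∀ i → (∀ j → SameBlock π i j → i Fin.≤ j) → min i ≡ i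
  min⁺ i h = Fin.≤-antisym (decreasing i) (h (min i) (sym (min-same i)))

  min⁻ : ∀ {i} → min i ≡ i → ∀ {j} → SameBlock π i j → i Fin.≤ j
  min⁻ {i} eq {j} i~j = subst (Fin._≤ j) eq (min-least i~j)

  nc-strict : ∀ {a b c d} → a Fin.< b → b Fin.< c → c Fin.< d →
              SameBlock π a c → SameBlock π b d → SameBlock π a b
  nc-strict {a} {b} {c} {d} = noncrossing {a} {b} {c} {d}

  -- A pair with one point strictly between the ends of the block of `x` and the other beyond them
  -- would cross the pair formed by these two ends. Hence the interval spanned by a block is a union
  -- of blocks.
  hull-closed : ∀ x {a b} → SameBlock π a b → min x Fin.≤ a → a Fin.≤ max x →
                min x Fin.≤ b × b Fin.≤ max x
  hull-closed x {a} {b} a~b u≤a a≤v with sameBlock? π a x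
  ... | yes a~x = min-least x~b , max-greatest x~b
    where x~b = trans (sym a~x) a~b
  ... | no ¬a~x = ℕ.≮⇒≥ b≮u , ℕ.≮⇒≥ v≮b
    where
    u~v = trans (min-same x) (max-same x)
    u<a : min x Fin.< a
    u<a = Fin.≤∧≢⇒< u≤a λ { refl → ¬a~x (min-same x) }
    a<v : a Fin.< max x
    a<v = Fin.≤∧≢⇒< a≤v λ { refl → ¬a~x (sym (max-same x)) }
    b≮u : ¬ b Fin.< min x
    b≮u b<u = ¬a~x (trans a~b (trans (nc-strict b<u u<a a<v (sym a~b) u~v) (min-same x)))
    v≮b : ¬ max x Fin.< b
    v≮b v<b = ¬a~x (trans (sym (nc-strict u<a a<v v<b u~v a~b)) (min-same x))

-- The refinement order.

≤-refl : (π : NC n) → π ≤ π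
≤-refl π i j = id

≤-trans : (π σ τ : NC n) → π ≤ σ → σ ≤ τ → π ≤ τ
≤-trans π σ τ p q i j = q i j ∘ p i j

≤-antisym : (π σ : NC n) → π ≤ σ → σ ≤ π → π ≡ σ
≤-antisym π σ p q = rep-injective (lookup-ext λ i → Fin.≤-antisym
  (min-least π (q i (min σ i) (sym (min-same σ i))))
  (min-least σ (p i (min π i) (sym (min-same π i)))))

≤-wlog : (π σ : NC n) → (∀ i j → i Fin.< j → SameBlock π i j → SameBlock σ i j) → π ≤ σ
≤-wlog π σ h i j i~j with Fin.<-cmp i j
... | tri< i<j _ _ = h i j i<j i~j
... | tri≈ _ refl _ = refl
... | tri> _ _ j<i = sym (h j i j<i (sym i~j))

-- If the labels of `σ` and `τ` differ at a point, the label in `σ` is first in its block of `σ` but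
-- not in its block of `τ`, which the last hypothesis forbids.
≡-by-min : (σ τ : NC n) → σ ≤ τ →
           (∀ i j → j Fin.< i → SameBlock τ i j → min σ i ≢ i) → σ ≡ τ
≡-by-min σ τ σ≤τ h = ≤-antisym σ τ σ≤τ λ i j i~j →
  trans (same i) (trans i~j (sym (same j)))
  where
  same : ∀ i → min σ i ≡ min τ i
  same i = Fin.≤-antisym
    (ℕ.≮⇒≥ λ lt → h m (min τ i) lt (trans i~m (sym (min-same τ i))) (min-same σ i))
    (min-least τ (sym i~m))
    where
    m = min σ i
    i~m : SameBlock τ m i
    i~m = σ≤τ m i (min-same σ i)

-- The mirror image. As labels are first points, each point is compared with the last point of its
-- block, which is the same for `σ` and `τ`.
≡-by-max : (σ τ : NC n) → σ ≤ τ →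
           (∀ i j → i Fin.< j → SameBlock τ i j → max σ i ≢ i) → σ ≡ τ
≡-by-max σ τ σ≤τ h = ≤-antisym σ τ σ≤τ λ i j i~j →
  trans (max-same σ i)
  (trans (cong (lookup (rep σ)) (trans (same i) (trans (max-cong τ i~j) (sym (same j)))))
         (sym (max-same σ j)))
  where
  same : ∀ i → max σ i ≡ max τ i
  same i = Fin.≤-antisym
    (max-greatest τ i~m)
    (ℕ.≮⇒≥ λ lt → h m (max τ i) lt (trans (sym i~m) (max-same τ i))
      (sym (max-cong σ (max-same σ i))))
    where
    m = max σ i
    i~m : SameBlock τ i m
    i~m = σ≤τ i m (max-same σ i)

-- The Kreweras complement and its inverse

-- Whether `a` lies between the primed points of `i` and `j`, in either order. It unfolds to the
-- same term as `Kreweras.sep` but has no partition as a parameter.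
sep : Fin n → Fin n → Fin n → Bool
sep i j a = does (a Fin.≤? i) xor does (a Fin.≤? j)

In : Fin n → Fin n → Fin n → Set
In i j a = i Fin.< a × a Fin.≤ j

In⇒sep : (i j a : Fin n) → In i j a → sep i j a ≡ true
In⇒sep i j a (i<a , a≤j) =
  cong₂ _xor_ (dec-false (a Fin.≤? i) (ℕ.<⇒≱ i<a)) (dec-true (a Fin.≤? j) a≤j)

sep-sym : ∀ (i j a : Fin n) → sep i j a ≡ sep j i a
sep-sym i j a = Bool.xor-comm (does (a Fin.≤? i)) (does (a Fin.≤? j))

sep⇒In : ∀ (i j a : Fin n) → sep i j a ≡ true → In i j a ⊎ In j i a
sep⇒In i j a eq with a Fin.≤? i | a Fin.≤? j
... | yes a≤i | no a≰j = inj₂ (ℕ.≰⇒> a≰j , a≤i)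
... | no a≰i | yes a≤j = inj₁ (ℕ.≰⇒> a≰i , a≤j)
... | yes a≤i | yes a≤j with () ← trans (sym eq)
  (cong₂ _xor_ (dec-true (a Fin.≤? i) a≤i) (dec-true (a Fin.≤? j) a≤j))
... | no a≰i | no a≰j with () ← trans (sym eq)
  (cong₂ _xor_ (dec-false (a Fin.≤? i) a≰i) (dec-false (a Fin.≤? j) a≰j))

sep-transfer : ∀ (i j a b : Fin n) → sep i j a ≡ sep i j b → In i j a → In i j b
sep-transfer i j a b eq a∈@(i<a , a≤j) with sep⇒In i j b (trans (sym eq) (In⇒sep i j a a∈))
... | inj₁ b∈ = b∈
... | inj₂ (j<b , b≤i) = contradiction (ℕ.<-≤-trans i<a a≤j)
                                       (ℕ.≤⇒≯ (ℕ.≤-trans (ℕ.<⇒≤ j<b) b≤i))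

-- The separated points form an interval; this makes the relation in `Kreweras⁻¹` non-crossing.
sep-convex : ∀ (i j a b c : Fin n) → a Fin.≤ b → b Fin.≤ c →
             sep i j a ≡ true → sep i j c ≡ true → sep i j b ≡ true
sep-convex i j a b c a≤b b≤c p q with sep⇒In i j a p | sep⇒In i j c q
... | inj₁ (i<a , _) | inj₁ (_ , c≤j) = In⇒sep i j b (ℕ.<-≤-trans i<a a≤b , ℕ.≤-trans b≤c c≤j)
... | inj₁ (i<a , a≤j) | inj₂ (j<c , c≤i) = contradiction (ℕ.<-≤-trans i<a a≤j)
                                              (ℕ.≤⇒≯ (ℕ.≤-trans (ℕ.<⇒≤ j<c) c≤i))
... | inj₂ (j<a , a≤i) | inj₁ (i<c , c≤j) = contradiction (ℕ.<-≤-trans j<a a≤i)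
                                              (ℕ.≤⇒≯ (ℕ.≤-trans (ℕ.<⇒≤ i<c) c≤j))
... | inj₂ (j<a , _) | inj₂ (_ , c≤i) =
  trans (sep-sym i j b) (In⇒sep j i b (ℕ.<-≤-trans j<a a≤b , ℕ.≤-trans b≤c c≤i))

-- One implication suffices because `SameBlock` is symmetric, and `i ≤ j` rules out the interval
-- that starts at `j`.
kr⁺ : (π : NC n) → ∀ {i j} → i Fin.≤ j →
      (∀ a b → SameBlock π a b → In i j a → In i j b) → SameBlock (Kr π) i j
kr⁺ π {i} {j} i≤j h = Kreweras.K.preserves π λ a b a~b →
  Bool.⇔→≡ {z = true} (mk⇔ (imp a b a~b) (imp b a (sym a~b)))
  where
  imp : ∀ a b → SameBlock π a b → sep i j a ≡ true → sep i j b ≡ true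
  imp a b a~b p with sep⇒In i j a p
  ... | inj₁ a∈ = In⇒sep i j b (h a b a~b a∈)
  ... | inj₂ (j<a , a≤i) = contradiction i≤j (ℕ.<⇒≱ (ℕ.<-≤-trans j<a a≤i))

kr-sep : (π : NC n) → ∀ {i j} → SameBlock (Kr π) i j →
         ∀ a b → SameBlock π a b → sep i j a ≡ sep i j b
kr-sep π = Kreweras.K.reflects π

kr⁻ : (π : NC n) → ∀ {i j} → SameBlock (Kr π) i j → ∀ a b → SameBlock π a b → In i j a → In i j b
kr⁻ π {i} {j} i~j a b a~b = sep-transfer i j a b (kr-sep π i~j a b a~b)

-- The condition that defines `Kr`, read the other way: two points are joined when no pair in a
-- block of `σ` has exactly one of them between its primed points.
module Kreweras⁻¹ (σ : NC n) where

  _~_ : Fin n → Fin n → Set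
  a ~ b = ∀ i j → SameBlock σ i j → sep i j a ≡ sep i j b

  _~?_ : ∀ a b → Dec (a ~ b)
  a ~? b = Fin.all? λ i → Fin.all? λ j → sameBlock? σ i j →-dec (sep i j a Bool.≟ sep i j b)

  noncrossing : NonCrossing Fin._<_ _~_
  noncrossing {a} {b} {c} {d} a<b b<c c<d a~c b~d i j i~j = Bool.⇔→≡ {z = true} (mk⇔
    (λ p → sep-convex i j a b c (ℕ.<⇒≤ a<b) (ℕ.<⇒≤ b<c) p (trans (sym (a~c i j i~j)) p))
    (λ p → trans (a~c i j i~j)
      (sep-convex i j b c d (ℕ.<⇒≤ b<c) (ℕ.<⇒≤ c<d) p (trans (sym (b~d i j i~j)) p))))

  isEquivalence : IsEquivalence _~_
  isEquivalence = record
    { refl  = λ _ _ _ → refl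
    ; sym   = λ p i j i~j → sym (p i j i~j)
    ; trans = λ p q i j i~j → trans (p i j i~j) (q i j i~j)
    }

  module K = FromEquivalence _~?_ isEquivalence noncrossing

abstract

  Kr⁻¹ : NC n → NC n
  Kr⁻¹ σ = Kreweras⁻¹.K.partition σ

  kr⁻¹-preserves : (σ : NC n) → ∀ {a b} → Kreweras⁻¹._~_ σ a b → SameBlock (Kr⁻¹ σ) a b
  kr⁻¹-preserves σ = Kreweras⁻¹.K.preserves σ

  kr⁻¹-reflects : (σ : NC n) → ∀ {a b} → SameBlock (Kr⁻¹ σ) a b → Kreweras⁻¹._~_ σ a b
  kr⁻¹-reflects σ = Kreweras⁻¹.K.reflects σ

galois⇒ : (π σ : NC n) → π ≤ Kr⁻¹ σ → σ ≤ Kr π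
galois⇒ π σ p i j i~j = Kreweras.K.preserves π λ a b a~b →
  kr⁻¹-reflects σ (p a b a~b) i j i~j

galois⇐ : (π σ : NC n) → σ ≤ Kr π → π ≤ Kr⁻¹ σ
galois⇐ π σ p a b a~b = kr⁻¹-preserves σ λ i j i~j →
  kr-sep π (p i j i~j) a b a~b

-- The primed points between `a` and `b` are those with `a ≤ i < b`, so the criterion asks that this
-- interval be a union of blocks of `σ`.
kr⁻¹⁺ : (σ : NC n) → ∀ {a b} → a Fin.≤ b →
        (∀ i j → SameBlock σ i j → a Fin.≤ i → i Fin.< b → a Fin.≤ j × j Fin.< b) →
        SameBlock (Kr⁻¹ σ) a b
kr⁻¹⁺ σ {a} {b} a≤b h = kr⁻¹-preserves σ λ i j i~j →
  Bool.⇔→≡ {z = true} (mk⇔ (to i j i~j) (from i j i~j))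
  where
  In-to : ∀ i j → SameBlock σ i j → In i j a → In i j b
  In-to i j i~j (i<a , a≤j) = ℕ.<-≤-trans i<a a≤b , ℕ.≮⇒≥ λ j<b →
    ℕ.<⇒≱ i<a (proj₁ (h j i (sym i~j) a≤j j<b))
  In-from : ∀ i j → SameBlock σ i j → In i j b → In i j a
  In-from i j i~j (i<b , b≤j) = i<a , ℕ.≤-trans a≤b b≤j
    where i<a = ℕ.≰⇒> λ a≤i → ℕ.<⇒≱ (proj₂ (h i j i~j a≤i i<b)) b≤j
  both : ∀ i j → SameBlock σ i j → ∀ x y → (∀ i j → SameBlock σ i j → In i j x → In i j y) →
         sep i j x ≡ true → sep i j y ≡ true
  both i j i~j x y f p with sep⇒In i j x p
  ... | inj₁ x∈ = In⇒sep i j y (f i j i~j x∈)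
  ... | inj₂ x∈ = trans (sep-sym i j y) (In⇒sep j i y (f j i (sym i~j) x∈))
  to = λ i j i~j → both i j i~j a b In-to
  from = λ i j i~j → both i j i~j b a In-from

kr⁻¹⁻ : (σ : NC n) → ∀ {a b} → SameBlock (Kr⁻¹ σ) a b →
        ∀ i j → SameBlock σ i j → a Fin.≤ i → i Fin.< b → a Fin.≤ j × j Fin.< b
kr⁻¹⁻ σ {a} {b} a~b i j i~j a≤i i<b =
    ℕ.≮⇒≥ (λ j<a → ℕ.<⇒≱ i<b (proj₂ (sep-transfer j i a b (eq j i (sym i~j)) (j<a , a≤i))))
  , ℕ.≰⇒> (λ b≤j → ℕ.<⇒≱ (proj₁ (sep-transfer i j b a (sym (eq i j i~j)) (i<b , b≤j))) a≤i)
  where eq = λ i j → kr⁻¹-reflects σ a~b i j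

-- By `hull-closed`, the points after `p` up to the last point of the block of `x` form a union of
-- blocks of `π`. This is the source of explicit pairs in the complement.
kr-hull : (π : NC n) → ∀ p x → suc (toℕ p) ≡ toℕ (min π x) → SameBlock (Kr π) p (max π x)
kr-hull π p x eq = kr⁺ π
  (ℕ.≤-trans (ℕ.n≤1+n _) (ℕ.≤-trans (ℕ.≤-reflexive eq)
    (ℕ.≤-trans (min-least π refl) (max-greatest π refl))))
  λ a b a~b (p<a , a≤s) → case hull-closed π x a~b (ℕ.≤-trans (ℕ.≤-reflexive (sym eq)) p<a) a≤s of
    λ (u≤b , b≤s) → ℕ.≤-trans (ℕ.≤-reflexive eq) u≤b , b≤s

-- The mirror image: the half-open interval from the first point of the block up to `q` is again its
-- hull.
kr⁻¹-hull : (σ : NC n) → ∀ q x → toℕ q ≡ suc (toℕ (max σ x)) → SameBlock (Kr⁻¹ σ) (min σ x) q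
kr⁻¹-hull σ q x eq = kr⁻¹⁺ σ
  (ℕ.≤-trans (ℕ.≤-trans (min-least σ refl) (max-greatest σ refl))
             (ℕ.≤-trans (ℕ.n≤1+n _) (ℕ.≤-reflexive (sym eq))))
  λ i j i~j u≤i i<q → case hull-closed σ x i~j u≤i (ℕ.≤-pred (ℕ.≤-trans i<q (ℕ.≤-reflexive eq))) of
    λ (u≤j , j≤s) → u≤j , ℕ.≤-trans (s≤s j≤s) (ℕ.≤-reflexive (sym eq))

-- Suppose that `i` is first in its block of `π` but is joined to an earlier `j`. The predecessor
-- `p` of `i` is joined in `Kr π` to the last point of the block of `i`, and this pair separates `j`
-- from `i`.
Kr⁻¹∘Kr : (π : NC n) → Kr⁻¹ (Kr π) ≡ π
Kr⁻¹∘Kr π = sym (≡-by-min π (Kr⁻¹ (Kr π)) (galois⇐ π (Kr π) (≤-refl (Kr π))) λ i j j<i i~j m≡i →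
  let p , eq = predecessor j i j<i in
  ℕ.≤⇒≯ (max-greatest π {i} refl)
    (proj₂ (kr⁻¹⁻ (Kr π) (sym i~j) p (max π i) (kr-hull π p i (trans eq (cong toℕ (sym m≡i))))
      (ℕ.≤-pred (ℕ.≤-trans j<i (ℕ.≤-reflexive (sym eq)))) (ℕ.≤-reflexive eq))))

-- Dually, if `i` is last in its block of `σ`, the first point of that block and the successor `q`
-- of `i` form a pair of `Kr⁻¹ σ`, of which only `q` lies between the primed points of `i` and `j`.
Kr∘Kr⁻¹ : (σ : NC n) → Kr (Kr⁻¹ σ) ≡ σ
Kr∘Kr⁻¹ σ = sym (≡-by-max σ (Kr (Kr⁻¹ σ)) (galois⇒ (Kr⁻¹ σ) σ (≤-refl (Kr⁻¹ σ))) λ i j i<j i~j m≡i →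
  let q , eq = successor i j i<j in
  ℕ.≤⇒≯ (min-least σ {i} refl)
    (proj₁ (kr⁻ (Kr⁻¹ σ) i~j q (min σ i)
      (sym (kr⁻¹-hull σ q i (trans eq (cong (suc ∘ toℕ) (sym m≡i)))))
      (ℕ.≤-reflexive (sym eq) , ℕ.≤-trans (ℕ.≤-reflexive eq) i<j))))

-- If the block of `i` in `Kr π` continues beyond `i`, the interval from `q` to its last point is a
-- union of blocks of `π`, so nothing before `q` is joined to `q`.
Kr-nonmax⇒ : (π : NC n) → ∀ i q → toℕ q ≡ suc (toℕ i) → max (Kr π) i ≢ i → min π q ≡ q
Kr-nonmax⇒ π i q eq ≢i = min⁺ π q λ b q~b → ℕ.≤-trans (ℕ.≤-reflexive eq)
  (proj₁ (kr⁻ π (max-same (Kr π) i) q b q~b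
    (ℕ.≤-reflexive (sym eq) , ℕ.≤-trans (ℕ.≤-reflexive eq) i<m)))
  where i<m = Fin.≤∧≢⇒< (max-greatest (Kr π) {i} refl) (≢i ∘ sym)

-- `kr-hull` joins `i` to the last point of the block of `q`, which lies beyond `i`.
Kr-nonmax⇐ : (π : NC n) → ∀ i q → toℕ q ≡ suc (toℕ i) → min π q ≡ q → max (Kr π) i ≢ i
Kr-nonmax⇐ π i q eq q-min max≡i = ℕ.<⇒≱
  (ℕ.≤-trans (ℕ.≤-reflexive (sym eq)) (max-greatest π {q} refl))
  (ℕ.≤-trans (max-greatest (Kr π) (kr-hull π i q (trans (sym eq) (cong toℕ (sym q-min)))))
             (ℕ.≤-reflexive (cong toℕ max≡i)))

-- Restriction to blocks and gluing

elements-∈ : (W : Subset n) (p : Fin ∣ W ∣) → lookup W (elements W p) ≡ true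
elements-∈ (true  ∷ W) zero    = refl
elements-∈ (true  ∷ W) (suc p) = elements-∈ W p
elements-∈ (false ∷ W) p       = elements-∈ W p

elements-onto : (W : Subset n) (i : Fin n) → lookup W i ≡ true → ∃[ p ] elements W p ≡ i
elements-onto (true  ∷ W) zero    _ = zero , refl
elements-onto (true  ∷ W) (suc i) h with p , eq ← elements-onto W i h = suc p , cong suc eq
elements-onto (false ∷ W) (suc i) h with p , eq ← elements-onto W i h = p , cong suc eq

elements-mono-≤ : (W : Subset n) (p q : Fin ∣ W ∣) → p Fin.≤ q → elements W p Fin.≤ elements W q
elements-mono-≤ W p q p≤q with Fin.<-cmp p q
... | tri< p<q _ _ = ℕ.<⇒≤ (elements-mono W p<q)
... | tri≈ _ refl _ = ℕ.≤-refl
... | tri> _ _ q<p = contradiction p≤q (ℕ.<⇒≱ q<p)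

elements-cancel-< : (W : Subset n) (p q : Fin ∣ W ∣) → elements W p Fin.< elements W q → p Fin.< q
elements-cancel-< W p q lt = ℕ.≰⇒> (λ q≤p → ℕ.<⇒≱ lt (elements-mono-≤ W q p q≤p))

elements-cancel-≤ : (W : Subset n) (p q : Fin ∣ W ∣) → elements W p Fin.≤ elements W q → p Fin.≤ q
elements-cancel-≤ W p q le = ℕ.≮⇒≥ (λ q<p → ℕ.<⇒≱ (elements-mono W q<p) le)

elements-injective : (W : Subset n) (p q : Fin ∣ W ∣) → elements W p ≡ elements W q → p ≡ q
elements-injective W p q eq = Fin.≤-antisym
  (elements-cancel-≤ W p q (ℕ.≤-reflexive (cong toℕ eq)))
  (elements-cancel-≤ W q p (ℕ.≤-reflexive (cong toℕ (sym eq))))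

≡-on-isEquivalence : ∀ {a b} {A : Set a} {B : Set b} (f : A → B) →
                     IsEquivalence (λ x y → f x ≡ f y)
≡-on-isEquivalence f = record { refl = refl ; sym = sym ; trans = trans }

-- The same data as in `_↾_`, so that `preserves` and `reflects` apply to its partition.
module Restriction {n} (π : NC n) (W : Subset n) = FromEquivalence
  {_~_ = λ p q → SameBlock π (elements W p) (elements W q)}
  (λ i j → sameBlock? π (elements W i) (elements W j))
  (≡-on-isEquivalence (lookup (rep π) ∘ elements W))
  (λ a<b b<c c<d → IsNC.noncrossing (isNC π)
    (elements-mono W a<b) (elements-mono W b<c) (elements-mono W c<d))

↾⁺ : (π : NC n) (W : Subset n) → ∀ {p q} →
     SameBlock π (elements W p) (elements W q) → SameBlock (π ↾ W) p q
↾⁺ π W = Restriction.preserves π W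

↾⁻ : (π : NC n) (W : Subset n) → ∀ {p q} →
     SameBlock (π ↾ W) p q → SameBlock π (elements W p) (elements W q)
↾⁻ π W = Restriction.reflects π W

∈block⁺ : (σ : NC n) → ∀ m i → SameBlock σ m i → lookup (block σ m) i ≡ true
∈block⁺ σ m i m~i = trans (Vec.lookup∘tabulate _ i) (dec-true (sameBlock? σ m i) m~i)

∈block⁻ : (σ : NC n) → ∀ m i → lookup (block σ m) i ≡ true → SameBlock σ m i
∈block⁻ σ m i eq with sameBlock? σ m i in eq′
... | yes m~i = m~i
... | no  m≁i with () ← trans (sym eq)
  (trans (Vec.lookup∘tabulate _ i) (dec-false (sameBlock? σ m i) m≁i))

elements-same : (σ : NC n) → ∀ m p → SameBlock σ m (elements (block σ m) p)
elements-same σ m p = ∈block⁻ σ m _ (elements-∈ (block σ m) p)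

block-point : (σ : NC n) → ∀ m i → SameBlock σ m i → ∃[ p ] elements (block σ m) p ≡ i
block-point σ m i m~i = elements-onto (block σ m) i (∈block⁺ σ m i m~i)

module Glue (σ : NC n) (θ : ∀ m → NC ∣ block σ m ∣) where

  -- Positions in the block of `m` are carried as witnesses, since `elements` has no inverse defined
  -- on all of `Fin n`.
  At : Fin n → Fin n → Fin n → Set
  At m i j = ∃[ p ] ∃[ q ]
    elements (block σ m) p ≡ i × elements (block σ m) q ≡ j × SameBlock (θ m) p q

  -- The first point of a block stands for the block, so that θ is only
  -- used at one index for each block.
  _~_ : Fin n → Fin n → Set
  i ~ j = At (min σ i) i j

  _~?_ : ∀ i j → Dec (i ~ j)
  i ~? j = Fin.any? λ p → Fin.any? λ q →
    (elements (block σ (min σ i)) p Fin.≟ i) ×-dec (elements (block σ (min σ i)) q Fin.≟ j)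
      ×-dec sameBlock? (θ (min σ i)) p q

  ~⇒same : ∀ {i j} → i ~ j → SameBlock σ i j
  ~⇒same {i} (p , q , eq , eq′ , _) =
    trans (sym (subst (SameBlock σ _) eq (elements-same σ _ p)))
          (subst (SameBlock σ _) eq′ (elements-same σ _ q))

  ~-refl : ∀ {i} → i ~ i
  ~-refl {i} with p , eq ← elements-onto (block σ (min σ i)) i (∈block⁺ σ _ i (min-same σ i)) =
    p , p , eq , eq , refl

  ~-sym : ∀ {i j} → i ~ j → j ~ i
  ~-sym {i} {j} i~j@(p , q , eq , eq′ , p~q) =
    subst (λ m → At m j i) (~⇒same i~j) (q , p , eq′ , eq , sym p~q)

  ~-trans : ∀ {i j k} → i ~ j → j ~ k → i ~ k
  ~-trans {i} {j} {k} i~j j~k = join i~j (subst (λ m → At m j k) (sym (~⇒same i~j)) j~k)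
    where
    join : ∀ {m} → At m i j → At m j k → At m i k
    join {m} (p , q , eq , eq′ , p~q) (q′ , r , eq″ , eq‴ , q′~r) =
      p , r , eq , eq‴ , trans p~q (trans (cong (lookup (rep (θ m)))
        (elements-injective (block σ m) q q′ (trans eq′ (sym eq″)))) q′~r)

  -- Two crossing pairs lie in one block of `σ`, because `σ` is non-crossing. The enumeration of
  -- that block reflects the order, so the crossing passes to the partition that `θ` assigns to it,
  -- which is non-crossing too.
  ~-noncrossing : NonCrossing Fin._<_ _~_
  ~-noncrossing {a} {b} {c} {d} a<b b<c c<d a~c b~d =
    combine a~c (subst (λ m → At m b d)
      (sym (nc-strict σ a<b b<c c<d (~⇒same a~c) (~⇒same b~d))) b~d)
    where
    combine : ∀ {m} → At m a c → At m b d → At m a b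
    combine {m} (p , r , refl , refl , p~r) (q , s , refl , refl , q~s) =
      p , q , refl , refl , nc-strict (θ m)
        (elements-cancel-< W p q a<b) (elements-cancel-< W q r b<c) (elements-cancel-< W r s c<d)
        p~r q~s
      where W = block σ m

  ~-isEquivalence : IsEquivalence _~_
  ~-isEquivalence = record { refl = ~-refl ; sym = ~-sym ; trans = ~-trans }

  module G = FromEquivalence _~?_ ~-isEquivalence ~-noncrossing

module _ (σ : NC n) (θ : ∀ m → NC ∣ block σ m ∣) where

  open Glue σ θ using (At)

  abstract

    glue : NC n
    glue = Glue.G.partition σ θ

    glue⁺ : ∀ {i j} → At (min σ i) i j → SameBlock glue i j
    glue⁺ = Glue.G.preserves σ θ

    glue⁻ : ∀ {i j} → SameBlock glue i j → At (min σ i) i j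
    glue⁻ = Glue.G.reflects σ θ

  glue-≤ : glue ≤ σ
  glue-≤ i j i~j = Glue.~⇒same σ θ (glue⁻ i~j)

  -- Claimed at first points, the indices at which gluing consults `θ`.
  glue-↾ : ∀ m → min σ m ≡ m → glue ↾ block σ m ≡ θ m
  glue-↾ m m-min = ≤-antisym _ _ to from
    where
    W = block σ m
    first : ∀ p → min σ (elements W p) ≡ m
    first p = trans (sym (elements-same σ m p)) m-min
    to : glue ↾ W ≤ θ m
    to p q p~q with p′ , q′ , eq , eq′ , r ←
        subst (λ k → At k (elements W p) (elements W q)) (first p) (glue⁻ (↾⁻ glue W p~q)) =
      subst₂ (SameBlock (θ m)) (elements-injective W p′ p eq) (elements-injective W q′ q eq′) r
    from : θ m ≤ glue ↾ W
    from p q p~q = ↾⁺ glue W (glue⁺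
      (subst (λ k → At k (elements W p) (elements W q)) (sym (first p)) (p , q , refl , refl , p~q)))

  glue-unique : ∀ τ → τ ≤ σ → (∀ m → min σ m ≡ m → τ ↾ block σ m ≡ θ m) → τ ≡ glue
  glue-unique τ τ≤σ τ↾ = ≤-antisym τ glue to from
    where
    to : τ ≤ glue
    to i j i~j =
      glue⁺ (p , q , eq , eq′ , subst (λ ψ → SameBlock ψ p q) (τ↾ m (min-same σ i))
        (↾⁺ τ W (subst₂ (SameBlock τ) (sym eq) (sym eq′) i~j)))
      where
      m = min σ i
      W = block σ m
      p∃ = elements-onto W i (∈block⁺ σ m i (min-same σ i))
      q∃ = elements-onto W j (∈block⁺ σ m j (trans (min-same σ i) (τ≤σ i j i~j)))
      p = proj₁ p∃
      q = proj₁ q∃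
      eq = proj₂ p∃
      eq′ = proj₂ q∃
    from : glue ≤ τ
    from i j i~j with p , q , eq , eq′ , p~q ← glue⁻ i~j =
      subst₂ (SameBlock τ) eq eq′
        (↾⁻ τ W (subst (λ ψ → SameBlock ψ p q) (sym (τ↾ m (min-same σ i))) p~q))
      where
      m = min σ i
      W = block σ m

  glued : ∀ i j → SameBlock σ i j →
          (∀ p q → elements (block σ (min σ i)) p ≡ i → elements (block σ (min σ i)) q ≡ j →
             SameBlock (θ (min σ i)) p q) →
          SameBlock glue i j
  glued i j i~j h = glue⁺ (p , q , eq , eq′ , h p q eq eq′)
    where
    p∃ = block-point σ (min σ i) i (min-same σ i)
    q∃ = block-point σ (min σ i) j (trans (min-same σ i) i~j)
    p = proj₁ p∃
    q = proj₁ q∃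
    eq = proj₂ p∃
    eq′ = proj₂ q∃

  glued⁻ : ∀ i j → SameBlock glue i j → ∀ p q →
           elements (block σ (min σ i)) p ≡ i → elements (block σ (min σ i)) q ≡ j →
           SameBlock (θ (min σ i)) p q
  glued⁻ i j i~j p q eq eq′ with p′ , q′ , e , e′ , r ← glue⁻ i~j =
    subst₂ (SameBlock (θ (min σ i)))
      (elements-injective (block σ (min σ i)) p′ p (trans e (sym eq)))
      (elements-injective (block σ (min σ i)) q′ q (trans e′ (sym eq′))) r

-- Complements within the blocks of a partition

Kr↾ Kr⁻¹↾ : (σ π : NC n) → ∀ m → NC ∣ block σ m ∣
Kr↾ σ π m = Kr (π ↾ block σ m)
Kr⁻¹↾ σ π m = Kr⁻¹ (π ↾ block σ m)

abstract

  -- For `π ≤ σ` this is the relative Kreweras complement of `π` in `σ`.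
  KrIn : NC n → NC n → NC n
  KrIn σ π = glue σ (Kr↾ σ π)

  KrIn-glue : (σ π : NC n) → KrIn σ π ≡ glue σ (Kr↾ σ π)
  KrIn-glue σ π = refl

  Kr⁻¹In : NC n → NC n → NC n
  Kr⁻¹In σ π = glue σ (Kr⁻¹↾ σ π)

  Kr⁻¹In-glue : (σ π : NC n) → Kr⁻¹In σ π ≡ glue σ (Kr⁻¹↾ σ π)
  Kr⁻¹In-glue σ π = refl

KrIn-≤ : (σ π : NC n) → KrIn σ π ≤ σ
KrIn-≤ σ π = subst (_≤ σ) (sym (KrIn-glue σ π)) (glue-≤ σ (Kr↾ σ π))

Kr⁻¹In-≤ : (σ π : NC n) → Kr⁻¹In σ π ≤ σ
Kr⁻¹In-≤ σ π = subst (_≤ σ) (sym (Kr⁻¹In-glue σ π)) (glue-≤ σ (Kr⁻¹↾ σ π))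

KrIn-↾ : (σ π : NC n) → ∀ m → min σ m ≡ m → KrIn σ π ↾ block σ m ≡ Kr (π ↾ block σ m)
KrIn-↾ σ π m m-min = trans (cong (_↾ block σ m) (KrIn-glue σ π))
  (glue-↾ σ (Kr↾ σ π) m m-min)

Kr⁻¹In-↾ : (σ π : NC n) → ∀ m → min σ m ≡ m → Kr⁻¹In σ π ↾ block σ m ≡ Kr⁻¹ (π ↾ block σ m)
Kr⁻¹In-↾ σ π m m-min = trans (cong (_↾ block σ m) (Kr⁻¹In-glue σ π))
  (glue-↾ σ (Kr⁻¹↾ σ π) m m-min)

module _ (σ π : NC n) where

  -- The criterion of `kr⁺` for one block, transported along `elements`: intervals are taken in
  -- `Fin n`, but only points `a` in the block of `i` in `σ` are tested.
  krIn⁺ : ∀ i j → i Fin.≤ j → SameBlock σ i j →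
          (∀ a b → SameBlock σ i a → SameBlock π a b → In i j a → In i j b) →
          SameBlock (KrIn σ π) i j
  krIn⁺ i j i≤j i~j h = subst (λ ρ → SameBlock ρ i j) (sym (KrIn-glue σ π))
    (glued σ (Kr↾ σ π) i j i~j λ p q eq eq′ →
    kr⁺ (π ↾ W) {p} {q}
      (elements-cancel-≤ W p q (subst₂ Fin._≤_ (sym eq) (sym eq′) i≤j))
      λ a b a~b (p<a , a≤q) →
        let i<b , b≤j = h (elements W a) (elements W b)
              (trans (sym (min-same σ i)) (elements-same σ m a)) (↾⁻ π W {a} {b} a~b)
              ( subst (Fin._< elements W a) eq (elements-mono W p<a)
              , subst (elements W a Fin.≤_) eq′ (elements-mono-≤ W a q a≤q))
        in elements-cancel-< W p b (subst (Fin._< elements W b) (sym eq) i<b)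
         , elements-cancel-≤ W b q (subst (elements W b Fin.≤_) (sym eq′) b≤j))
    where
    m = min σ i
    W = block σ m

  krIn⁻ : π ≤ σ → ∀ i j → SameBlock (KrIn σ π) i j →
          ∀ a b → SameBlock σ i a → SameBlock π a b → In i j a → In i j b
  krIn⁻ π≤σ i j i~j a b i~a a~b (i<a , a≤j) =
    subst₂ Fin._<_ eq eqb (elements-mono W (proj₁ d∈))
    , subst₂ Fin._≤_ eqb eq′ (elements-mono-≤ W d q (proj₂ d∈))
    where
    m = min σ i
    W = block σ m
    point = block-point σ m
    p = proj₁ (point i (min-same σ i))
    eq = proj₂ (point i (min-same σ i))
    m~j = trans (min-same σ i) (KrIn-≤ σ π i j i~j)
    q = proj₁ (point j m~j)
    eq′ = proj₂ (point j m~j)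
    c = proj₁ (point a (trans (min-same σ i) i~a))
    eqa = proj₂ (point a (trans (min-same σ i) i~a))
    m~b = trans (min-same σ i) (trans i~a (π≤σ a b a~b))
    d = proj₁ (point b m~b)
    eqb = proj₂ (point b m~b)
    d∈ : In p q d
    d∈ = kr⁻ (π ↾ W) {p} {q}
      (glued⁻ σ (Kr↾ σ π) i j (subst (λ ρ → SameBlock ρ i j) (KrIn-glue σ π) i~j) p q eq eq′) c d
      (↾⁺ π W {c} {d} (subst₂ (SameBlock π) (sym eqa) (sym eqb) a~b))
      ( elements-cancel-< W p c (subst₂ Fin._<_ (sym eq) (sym eqa) i<a)
      , elements-cancel-≤ W c q (subst₂ Fin._≤_ (sym eqa) (sym eq′) a≤j))

  kr⁻¹In⁺ : ∀ a b → a Fin.≤ b → SameBlock σ a b →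
            (∀ i j → SameBlock σ a i → SameBlock π i j → a Fin.≤ i → i Fin.< b →
               a Fin.≤ j × j Fin.< b) →
            SameBlock (Kr⁻¹In σ π) a b
  kr⁻¹In⁺ a b a≤b a~b h = subst (λ ρ → SameBlock ρ a b) (sym (Kr⁻¹In-glue σ π))
    (glued σ (Kr⁻¹↾ σ π) a b a~b λ p q eq eq′ →
    kr⁻¹⁺ (π ↾ W) {p} {q}
      (elements-cancel-≤ W p q (subst₂ Fin._≤_ (sym eq) (sym eq′) a≤b))
      λ i j i~j p≤i i<q →
        let a≤j , j<b = h (elements W i) (elements W j)
              (trans (sym (min-same σ a)) (elements-same σ m i)) (↾⁻ π W {i} {j} i~j)
              (subst (Fin._≤ elements W i) eq (elements-mono-≤ W p i p≤i))
              (subst (elements W i Fin.<_) eq′ (elements-mono W i<q))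
        in elements-cancel-≤ W p j (subst (Fin._≤ elements W j) (sym eq) a≤j)
         , elements-cancel-< W j q (subst (elements W j Fin.<_) (sym eq′) j<b))
    where
    m = min σ a
    W = block σ m

  kr⁻¹In⁻ : π ≤ σ → ∀ a b → SameBlock (Kr⁻¹In σ π) a b →
            ∀ i j → SameBlock σ a i → SameBlock π i j → a Fin.≤ i → i Fin.< b → a Fin.≤ j × j Fin.< b
  kr⁻¹In⁻ π≤σ a b a~b i j a~i i~j a≤i i<b =
    subst₂ Fin._≤_ eq eqj (elements-mono-≤ W p d (proj₁ d∈))
    , subst₂ Fin._<_ eqj eq′ (elements-mono W (proj₂ d∈))
    where
    m = min σ a
    W = block σ m
    point = block-point σ m
    p = proj₁ (point a (min-same σ a))
    eq = proj₂ (point a (min-same σ a))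
    m~b = trans (min-same σ a) (Kr⁻¹In-≤ σ π a b a~b)
    q = proj₁ (point b m~b)
    eq′ = proj₂ (point b m~b)
    c = proj₁ (point i (trans (min-same σ a) a~i))
    eqi = proj₂ (point i (trans (min-same σ a) a~i))
    m~j = trans (min-same σ a) (trans a~i (π≤σ i j i~j))
    d = proj₁ (point j m~j)
    eqj = proj₂ (point j m~j)
    d∈ : p Fin.≤ d × d Fin.< q
    d∈ = kr⁻¹⁻ (π ↾ W) {p} {q}
      (glued⁻ σ (Kr⁻¹↾ σ π) a b (subst (λ ρ → SameBlock ρ a b) (Kr⁻¹In-glue σ π) a~b) p q eq eq′) c d
      (↾⁺ π W {c} {d} (subst₂ (SameBlock π) (sym eqi) (sym eqj) i~j))
      (elements-cancel-≤ W p c (subst₂ Fin._≤_ (sym eq) (sym eqi) a≤i))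
      (elements-cancel-< W c q (subst₂ Fin._<_ (sym eqi) (sym eq′) i<b))

-- Comparison of the two relative complements.

Kr-antitone : (π σ : NC n) → π ≤ σ → Kr σ ≤ Kr π
Kr-antitone π σ π≤σ = galois⇒ π (Kr σ)
  (≤-trans π σ (Kr⁻¹ (Kr σ)) π≤σ (galois⇐ σ (Kr σ) (≤-refl (Kr σ))))

-- In terms of the permutations whose cycles are the blocks, both sides
-- are π⁻¹σ.
KrIn≡Kr⁻¹In : (π σ : NC n) → π ≤ σ → KrIn σ π ≡ Kr⁻¹In (Kr π) (Kr σ)
KrIn≡Kr⁻¹In {n} π σ π≤σ = ≡-by-min ρ ρ′ ρ≤ρ′ no-new
  where
  κ τ ρ ρ′ : NC n
  κ = Kr π
  τ = Kr σ
  ρ = KrIn σ π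
  ρ′ = Kr⁻¹In κ τ

  τ≤κ : τ ≤ κ
  τ≤κ = Kr-antitone π σ π≤σ

  ρ≤ρ′ : ρ ≤ ρ′
  ρ≤ρ′ = ≤-wlog ρ ρ′ λ i j i<j i~j →
    let iσj = KrIn-≤ σ π i j i~j in
    kr⁻¹In⁺ κ τ i j (ℕ.<⇒≤ i<j) (kr⁺ π (ℕ.<⇒≤ i<j) (within-κ i j i<j i~j iσj)) λ p q _ p~q i≤p p<j →
        -- A pair of `τ` cannot separate `i` from `j`, which share a block of `σ`.
        ℕ.≮⇒≥ (λ q<i → ℕ.<⇒≱ p<j (proj₂ (kr⁻ σ (sym p~q) i j iσj (q<i , i≤p))))
      , ℕ.≰⇒> (λ j≤q → ℕ.<⇒≱ (proj₁ (kr⁻ σ p~q j i (sym iσj) (p<j , j≤q))) i≤p)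
    where
    within-κ : ∀ i j → i Fin.< j → SameBlock ρ i j → SameBlock σ i j →
               ∀ a b → SameBlock π a b → In i j a → In i j b
    within-κ i j i<j i~j iσj a b a~b a∈@(i<a , a≤j) with sameBlock? σ i a
    ... | yes iσa = krIn⁻ σ π π≤σ i j i~j a b iσa a~b a∈
    -- Here the block of `a` in `σ` is not that of `i` and `j`. As `σ` is non-crossing, it stays
    -- between them, and `b` lies in it.
    ... | no  iσ̸a = ℕ.≤∧≢⇒< i≤b (i≢b ∘ Fin.toℕ-injective) , b≤j
      where
      aσb = π≤σ a b a~b
      a<j : a Fin.< j
      a<j = Fin.≤∧≢⇒< a≤j λ { refl → iσ̸a iσj }
      i≢b : i ≢ b
      i≢b refl = iσ̸a (sym aσb)
      i≤b : i Fin.≤ b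
      i≤b = ℕ.≮⇒≥ λ b<i → iσ̸a (trans (sym (nc-strict σ b<i i<a a<j (sym aσb) iσj)) (sym aσb))
      b≤j : b Fin.≤ j
      b≤j = ℕ.≮⇒≥ λ j<b → iσ̸a (nc-strict σ i<a a<j j<b iσj aσb)

  no-new : ∀ i j → j Fin.< i → SameBlock ρ′ i j → min ρ i ≢ i
  no-new i j j<i i~j i-min = absurd (min σ u Fin.≟ u)
    where
    u = min π i
    jκi : SameBlock κ j i
    jκi = sym (Kr⁻¹In-≤ κ τ i j i~j)
    -- The pair `j`, `i` of `κ` confines the block of `i` in `π` to the points after `j` up to `i`;
    -- hence `i` is its last point.
    j<u : j Fin.< u
    j<u = proj₁ (kr⁻ π jκi i u (sym (min-same π i)) (j<i , ℕ.≤-refl))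
    max≡i : max π i ≡ i
    max≡i = Fin.≤-antisym (proj₂ (kr⁻ π jκi i (max π i) (max-same π i) (j<i , ℕ.≤-refl)))
                          (max-greatest π refl)
    i≤max : i Fin.≤ max π i
    i≤max = max-greatest π refl
    u≤i : u Fin.≤ i
    u≤i = min-least π refl
    uσi : SameBlock σ u i
    uσi = π≤σ u i (min-same π i)

    absurd : Dec (min σ u ≡ u) → ⊥
    -- u = p + 1 starts a block of σ with last point y ≥ i, so that p′
    -- and y′ are in one block of τ.
    absurd (yes u-min) = ℕ.<⇒≱ (proj₂ (kr⁻¹In⁻ κ τ τ≤κ j i (sym i~j) p y jκp pτy j≤p p<i)) i≤y
      where
      p∃ = predecessor j u j<u
      p = proj₁ p∃
      y = max σ u
      p+1≡u = proj₂ p∃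
      i≤y : i Fin.≤ y
      i≤y = max-greatest σ uσi
      pτy : SameBlock τ p y
      pτy = kr-hull σ p u (trans p+1≡u (cong toℕ (sym u-min)))
      pκi : SameBlock κ p i
      pκi = subst (SameBlock κ p) max≡i (kr-hull π p i p+1≡u)
      jκp : SameBlock κ j p
      jκp = trans jκi (sym pκi)
      j≤p : j Fin.≤ p
      j≤p = ℕ.≤-pred (ℕ.≤-trans j<u (ℕ.≤-reflexive (sym p+1≡u)))
      p<i : p Fin.< i
      p<i = ℕ.≤-trans (ℕ.≤-reflexive p+1≡u) u≤i
    -- Otherwise i″ is joined to the point x″, x being the predecessor of
    -- u in its block of σ.
    absurd (no u-nonmin) = ℕ.<⇒≱ x<i (min⁻ ρ i-min (sym x~i))
      where
      below-u = greatest (λ k → (k Fin.<? u) ×-dec sameBlock? σ k u)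
        (min σ u , Fin.≤∧≢⇒< (min-least σ refl) u-nonmin , min-same σ u)
      x = proj₁ below-u
      x<u : x Fin.< u
      x<u = proj₁ (proj₁ (proj₂ below-u))
      xσu : SameBlock σ x u
      xσu = proj₂ (proj₁ (proj₂ below-u))
      x-last : ∀ k → k Fin.< u × SameBlock σ k u → k Fin.≤ x
      x-last = proj₂ (proj₂ below-u)
      x<i : x Fin.< i
      x<i = ℕ.<-≤-trans x<u u≤i
      x~i : SameBlock ρ x i
      x~i = krIn⁺ σ π x i (ℕ.<⇒≤ x<i) (trans xσu uσi) λ a b xσa a~b (x<a , a≤i) →
        let u≤a = ℕ.≮⇒≥ λ a<u → ℕ.<⇒≱ x<a (x-last a (a<u , trans (sym xσa) xσu))
            u≤b , b≤m = hull-closed π i a~b u≤a (ℕ.≤-trans a≤i i≤max)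
        in ℕ.<-≤-trans x<u u≤b , ℕ.≤-trans b≤m (ℕ.≤-reflexive (cong toℕ max≡i))

mins : NC n → List (Fin n)
mins {n} π = filter (λ i → lookup (rep π) i Fin.≟ i) (allFin n)

-- Sums over lists in a commutative monoid

allFin-suc : ∀ n → allFin (suc n) ≡ zero ∷ List.map suc (allFin n)
allFin-suc n = cong (zero ∷_) (sym (List.map-tabulate id suc))

-- Any commutative monoid is allowed, to serve sums in ℕ and in the tensor square of `Sym`, and
-- products in `Sym` and in its tensor square. `fold` unfolds to the `sum` and `product` of an
-- algebra.
module Fold {c ℓ} (M : CommutativeMonoid c ℓ) where

  open CommutativeMonoid M
    using ( Carrier; _≈_; _∙_; ε; ∙-cong; ∙-congˡ; ∙-congʳ
          ; assoc; comm; identityˡ; identityʳ; reflexive)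
    renaming (refl to ≈-refl; sym to ≈-sym; trans to ≈-trans)
  open import Algebra.Properties.CommutativeSemigroup (CommutativeMonoid.commutativeSemigroup M)
    using (interchange)

  fold : ∀ {a} {A : Set a} → List A → (A → Carrier) → Carrier
  fold xs f = foldr (λ x → f x ∙_) ε xs

  infix 8 _when_

  _when_ : Carrier → Bool → Carrier
  x when b = if b then x else ε

  module _ {a} {A : Set a} where

    fold-congᴬ : ∀ {xs} {f g : A → Carrier} → All (λ x → f x ≈ g x) xs → fold xs f ≈ fold xs g
    fold-congᴬ []       = ≈-refl
    fold-congᴬ (e ∷ es) = ∙-cong e (fold-congᴬ es)

    fold-cong : ∀ xs {f g : A → Carrier} → (∀ x → f x ≈ g x) → fold xs f ≈ fold xs g
    fold-cong []       e = ≈-refl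
    fold-cong (x ∷ xs) e = ∙-cong (e x) (fold-cong xs e)

    fold-ε : ∀ (xs : List A) → fold xs (λ _ → ε) ≈ ε
    fold-ε []       = ≈-refl
    fold-ε (x ∷ xs) = ≈-trans (identityˡ _) (fold-ε xs)

    fold-∙ : ∀ xs (f g : A → Carrier) → fold xs (λ x → f x ∙ g x) ≈ fold xs f ∙ fold xs g
    fold-∙ []       f g = ≈-sym (identityˡ ε)
    fold-∙ (x ∷ xs) f g = ≈-trans (∙-congˡ (fold-∙ xs f g)) (interchange _ _ _ _)

    fold-++ : ∀ xs ys (f : A → Carrier) → fold (xs ++ ys) f ≈ fold xs f ∙ fold ys f
    fold-++ []       ys f = ≈-sym (identityˡ _)
    fold-++ (x ∷ xs) ys f = ≈-trans (∙-congˡ (fold-++ xs ys f)) (≈-sym (assoc _ _ _))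

    fold-filter : ∀ {p} {P : A → Set p} (P? : Unary.Decidable P) xs (f : A → Carrier) →
                  fold (filter P? xs) f ≈ fold xs (λ x → f x when does (P? x))
    fold-filter P? []       f = ≈-refl
    fold-filter P? (x ∷ xs) f with does (P? x)
    ... | true  = ∙-congˡ (fold-filter P? xs f)
    ... | false = ≈-trans (fold-filter P? xs f) (≈-sym (identityˡ _))

    fold-↭ : ∀ {xs ys} (f : A → Carrier) → xs ↭ ys → fold xs f ≈ fold ys f
    fold-↭ f _↭_.refl = ≈-refl
    fold-↭ f (_↭_.prep x p) = ∙-congˡ (fold-↭ f p)
    fold-↭ f (_↭_.swap x y p) = ≈-trans (≈-sym (assoc _ _ _))
      (≈-trans (∙-cong (comm _ _) (fold-↭ f p)) (assoc _ _ _))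
    fold-↭ f (_↭_.trans p q) = ≈-trans (fold-↭ f p) (fold-↭ f q)

    module _ {b} {B : Set b} where

      fold-map : ∀ (h : A → B) xs (f : B → Carrier) → fold (List.map h xs) f ≡ fold xs (f ∘ h)
      fold-map h []       f = refl
      fold-map h (x ∷ xs) f = cong (f (h x) ∙_) (fold-map h xs f)

      fold-swap : ∀ xs ys (f : A → B → Carrier) →
                  fold xs (λ x → fold ys (f x)) ≈ fold ys (λ y → fold xs (λ x → f x y))
      fold-swap []       ys f = ≈-sym (go ys)
        where
        go : ∀ ys → fold ys (λ _ → ε) ≈ ε
        go []       = ≈-refl
        go (y ∷ ys) = ≈-trans (identityˡ _) (go ys)
      fold-swap (x ∷ xs) ys f = ≈-trans (∙-congˡ (fold-swap xs ys f)) (≈-sym (go ys))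
        where
        go : ∀ ys → fold ys (λ y → f x y ∙ fold xs (λ x → f x y)) ≈
                    fold ys (f x) ∙ fold ys (λ y → fold xs (λ x → f x y))
        go []       = ≈-sym (identityˡ ε)
        go (y ∷ ys) = ≈-trans (∙-congˡ (go ys)) (interchange _ _ _ _)

  fold-allFin-suc : (f : Fin (suc n) → Carrier) →
                    fold (allFin (suc n)) f ≡ f zero ∙ fold (allFin n) (f ∘ suc)
  fold-allFin-suc {n} f = trans (cong (λ xs → fold xs f) (allFin-suc n))
    (cong (f zero ∙_) (fold-map suc (allFin n) f))

  fold-allFin-last : ∀ n (f : Fin (suc n) → Carrier) →
    fold (allFin (suc n)) f ≈ fold (allFin n) (f ∘ Fin.inject₁) ∙ f (Fin.fromℕ n)
  fold-allFin-last zero    f = comm _ _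
  fold-allFin-last (suc n) f = ≈-trans (reflexive (fold-allFin-suc f))
    (≈-trans (∙-congˡ (fold-allFin-last n (f ∘ suc)))
    (≈-trans (≈-sym (assoc _ _ _)) (∙-congʳ (reflexive (sym (fold-allFin-suc (f ∘ Fin.inject₁)))))))

  fold-single : (m : Fin n) (g : Fin n → Carrier) →
                fold (allFin n) (λ i → g i when does (i Fin.≟ m)) ≈ g m
  fold-single {suc n} zero g = ≈-trans
    (reflexive (fold-allFin-suc (λ i → g i when does (i Fin.≟ zero))))
    (≈-trans (∙-congˡ (fold-ε (allFin n))) (identityʳ _))
  fold-single {suc n} (suc m) g = ≈-trans
    (reflexive (fold-allFin-suc (λ i → g i when does (i Fin.≟ suc m))))
    (≈-trans (identityˡ _) (fold-single m (g ∘ suc)))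

  fold-elements : (W : Subset n) (g : Fin n → Carrier) →
    fold (allFin ∣ W ∣) (g ∘ elements W) ≈ fold (allFin n) (λ i → g i when lookup W i)
  fold-elements [] g = ≈-refl
  fold-elements (true ∷ W) g = ≈-trans (reflexive (fold-allFin-suc (g ∘ elements (true ∷ W))))
    (≈-trans (∙-congˡ (fold-elements W (g ∘ suc)))
      (reflexive (sym (fold-allFin-suc (λ i → g i when lookup (true ∷ W) i)))))
  fold-elements (false ∷ W) g = ≈-trans (fold-elements W (g ∘ suc))
    (≈-trans (≈-sym (identityˡ _))
      (reflexive (sym (fold-allFin-suc (λ i → g i when lookup (false ∷ W) i)))))

  fold-blocks : (π : NC n) (g : Subset n → Carrier) →
    fold (blocks π) g ≈ fold (allFin n) (λ i → g (block π i) when does (min π i Fin.≟ i))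
  fold-blocks {n} π g = ≈-trans (reflexive (fold-map (block π) (mins π) g))
    (fold-filter (λ i → min π i Fin.≟ i) (allFin n) (g ∘ block π))

  -- After the two folds are swapped, each `i` is counted at the one block containing it, which is
  -- represented by `min σ i`.
  fold-over-blocks : (σ : NC n) (g : Fin n → Carrier) →
    fold (blocks σ) (λ W → fold (allFin n) (λ i → g i when lookup W i)) ≈ fold (allFin n) g
  fold-over-blocks {n} σ g =
    ≈-trans (fold-swap (blocks σ) (allFin n) (λ W i → g i when lookup W i))
    (fold-cong (allFin n) λ i →
      ≈-trans (fold-blocks σ (λ W → g i when lookup W i))
      (≈-trans (fold-cong (allFin n) (λ m → reflexive (is-first i m)))
               (fold-single (min σ i) (λ _ → g i))))
    where
    is-first : ∀ i m → (g i when lookup (block σ m) i) when does (min σ m Fin.≟ m) ≡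
                       g i when does (m Fin.≟ min σ i)
    is-first i m with min σ m Fin.≟ m
    ... | no m-nonmin = sym (cong (g i when_) (dec-false (m Fin.≟ min σ i)
            λ { refl → m-nonmin (min-same σ i) }))
    ... | yes m-min with m Fin.≟ min σ i
    ...   | yes refl = cong (g i when_) (∈block⁺ σ m i (min-same σ i))
    ...   | no m≢ = cong (g i when_) (Bool.¬-not λ eq → m≢ (trans (sym m-min) (∈block⁻ σ m i eq)))

module ℕSum = Fold ℕ.+-0-commutativeMonoid

-- Blocks of a restriction.

∣∣-sum : (W : Subset n) → ∣ W ∣ ≡ ℕSum.fold (allFin n) (λ i → if lookup W i then 1 else 0)
∣∣-sum [] = refl
∣∣-sum (true ∷ W) = trans (cong suc (∣∣-sum W))
  (sym (ℕSum.fold-allFin-suc (λ i → if lookup (true ∷ W) i then 1 else 0)))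
∣∣-sum (false ∷ W) = trans (∣∣-sum W)
  (sym (ℕSum.fold-allFin-suc (λ i → if lookup (false ∷ W) i then 1 else 0)))

if-cong-∧ : ∀ {a} {A : Set a} {x y : A} (b c : Bool) → (c ≡ true → b ≡ true) →
            (if b then (if c then x else y) else y) ≡ (if c then x else y)
if-cong-∧ true  c     h = refl
if-cong-∧ false false h = refl
if-cong-∧ false true  h with () ← h refl

module _ (ρ σ : NC n) (ρ≤σ : ρ ≤ σ) (m : Fin n) where

  private
    W = block σ m

  -- Since `ρ ≤ σ`, the block of `ρ` through a point of `W` lies entirely in `W`, so restricting
  -- loses none of its points.
  block-↾-size : ∀ p → ∣ block (ρ ↾ W) p ∣ ≡ ∣ block ρ (elements W p) ∣
  block-↾-size p =
    trans (∣∣-sum (block (ρ ↾ W) p))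
    (trans (ℕSum.fold-cong (allFin ∣ W ∣) same)
    (trans (ℕSum.fold-elements W (λ i → if lookup (block ρ (elements W p)) i then 1 else 0))
    (trans (ℕSum.fold-cong (allFin n)
             (λ i → if-cong-∧ (lookup W i) (lookup (block ρ (elements W p)) i) (inside i)))
    (sym (∣∣-sum (block ρ (elements W p)))))))
    where
    same : ∀ q → (if lookup (block (ρ ↾ W) p) q then 1 else 0) ≡
                 (if lookup (block ρ (elements W p)) (elements W q) then 1 else 0)
    same q = cong (λ b → if b then 1 else 0) (Bool.⇔→≡ {z = true} (mk⇔
      (λ e → ∈block⁺ ρ (elements W p) (elements W q) (↾⁻ ρ W {p} {q} (∈block⁻ (ρ ↾ W) p q e)))
      (λ e → ∈block⁺ (ρ ↾ W) p q (↾⁺ ρ W {p} {q} (∈block⁻ ρ (elements W p) (elements W q) e)))))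
    inside : ∀ i → lookup (block ρ (elements W p)) i ≡ true → lookup W i ≡ true
    inside i e = ∈block⁺ σ m i (trans (elements-same σ m p) (ρ≤σ _ i (∈block⁻ ρ (elements W p) i e)))

  first-↾ : ∀ p → does (min (ρ ↾ W) p Fin.≟ p) ≡ does (min ρ (elements W p) Fin.≟ elements W p)
  first-↾ p = does-⇔ (mk⇔ to from) (min (ρ ↾ W) p Fin.≟ p) (min ρ (elements W p) Fin.≟ elements W p)
    where
    to : min (ρ ↾ W) p ≡ p → min ρ (elements W p) ≡ elements W p
    to p-min = min⁺ ρ (elements W p) λ j p~j →
      let q , eq = block-point σ m j (trans (elements-same σ m p) (ρ≤σ _ j p~j))
      in subst (elements W p Fin.≤_) eq (elements-mono-≤ W p q
           (min⁻ (ρ ↾ W) p-min {q} (↾⁺ ρ W {p} {q} (subst (SameBlock ρ (elements W p)) (sym eq) p~j))))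
    from : min ρ (elements W p) ≡ elements W p → min (ρ ↾ W) p ≡ p
    from p-min = min⁺ (ρ ↾ W) p λ q p~q →
      elements-cancel-≤ W p q (min⁻ ρ p-min (↾⁻ ρ W {p} {q} p~q))

module FoldBlocks {c ℓ} (M : CommutativeMonoid c ℓ) where

  open CommutativeMonoid M using (Carrier; _≈_; reflexive) renaming (trans to ≈-trans; sym to ≈-sym)
  open Fold M

  -- By `ρ ≤ σ`, the blocks of the restrictions are the blocks of `ρ`. Folds over blocks become
  -- folds over first points, which `first-↾` and `block-↾-size` match up.
  fold-refine : (ρ σ : NC n) → ρ ≤ σ → (f : ℕ → Carrier) →
    fold (mins σ) (λ m → fold (blocks (ρ ↾ block σ m)) (λ V → f ∣ V ∣)) ≈
    fold (blocks ρ) (λ V → f ∣ V ∣)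
  fold-refine {n} ρ σ ρ≤σ f =
    ≈-trans (fold-cong (mins σ) part)
    (≈-trans (reflexive (sym (fold-map (block σ) (mins σ)
               (λ W → fold (allFin n) (λ i → g i when lookup W i)))))
    (≈-trans (fold-over-blocks σ g) (≈-sym (fold-blocks ρ (λ V → f ∣ V ∣)))))
    where
    g : Fin n → Carrier
    g i = f ∣ block ρ i ∣ when does (min ρ i Fin.≟ i)
    part : ∀ m → fold (blocks (ρ ↾ block σ m)) (λ V → f ∣ V ∣) ≈
                   fold (allFin n) (λ i → g i when lookup (block σ m) i)
    part m = ≈-trans (fold-blocks (ρ ↾ block σ m) (λ V → f ∣ V ∣))
      (≈-trans (fold-cong (allFin ∣ block σ m ∣) λ p → reflexive (cong₂ (λ k b → f k when b)
         (block-↾-size ρ σ ρ≤σ m p) (first-↾ ρ σ ρ≤σ m p)))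
      (fold-elements (block σ m) g))

-- Block sizes and enumeration

count : Bool → ℕ
count b = if b then 1 else 0

nonmax : NC n → Fin n → Bool
nonmax π i = not (does (max π i Fin.≟ i))

-- `nonmax` counts all points of the block except the last; `pointwise` restores that one as an
-- indicator, so that the truncated subtraction is exact.
block-size-pred : (π : NC n) → ∀ m →
  ∣ block π m ∣ ∸ 1 ≡
  ℕSum.fold (allFin n) (λ i → if lookup (block π m) i then count (nonmax π i) else 0)
block-size-pred {n} π m = trans (cong (_∸ 1) size) (ℕ.m+n∸n≡m _ 1)
  where
  W = block π m
  f : Fin n → ℕ
  f i = if lookup W i then count (nonmax π i) else 0
  pointwise : ∀ i → count (lookup W i) ≡ f i ℕ.+ count (does (i Fin.≟ max π m))
  pointwise i with lookup W i in eq
  ... | false = sym (cong count (dec-false (i Fin.≟ max π m) λ { refl →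
          contradiction (trans (sym eq) (∈block⁺ π m i (max-same π m))) λ () }))
  ... | true with m~i ← ∈block⁻ π m i eq with max π i Fin.≟ i
  ...   | yes e = sym (cong count (dec-true (i Fin.≟ max π m) (trans (sym e) (sym (max-cong π m~i)))))
  ...   | no ≢i = sym (cong (suc ∘ count) (dec-false (i Fin.≟ max π m) λ e →
            ≢i (trans (sym (max-cong π m~i)) (sym e))))
  size : ∣ W ∣ ≡ ℕSum.fold (allFin n) f ℕ.+ 1
  size = trans (∣∣-sum W) (trans (ℕSum.fold-cong (allFin n) pointwise)
    (trans (ℕSum.fold-∙ (allFin n) f (λ i → count (does (i Fin.≟ max π m))))
           (cong (ℕSum.fold (allFin n) f ℕ.+_) (ℕSum.fold-single (max π m) (λ _ → 1)))))

-- The degree of `Yₚ π`.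
excess : NC n → ℕ
excess π = ℕSum.fold (blocks π) (λ V → ∣ V ∣ ∸ 1)

excess-nonmax : (π : NC n) → excess π ≡ ℕSum.fold (allFin n) (count ∘ nonmax π)
excess-nonmax {n} π =
  trans (ℕSum.fold-map (block π) (mins π) (λ V → ∣ V ∣ ∸ 1))
  (trans (ℕSum.fold-cong (mins π) (block-size-pred π))
  (trans (sym (ℕSum.fold-map (block π) (mins π)
           (λ W → ℕSum.fold (allFin n) (λ i → if lookup W i then count (nonmax π i) else 0))))
         (ℕSum.fold-over-blocks π (count ∘ nonmax π))))

first : NC (suc n) → Fin n → Bool
first π i = does (min π (suc i) Fin.≟ suc i)

later-blocks : NC (suc n) → ℕ
later-blocks {n} π = ℕSum.fold (allFin n) (count ∘ first π)

length-fold : ∀ {a} {A : Set a} (xs : List A) → length xs ≡ ℕSum.fold xs (λ _ → 1)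
length-fold []       = refl
length-fold (x ∷ xs) = cong suc (length-fold xs)

#blocks-later : (π : NC (suc n)) → #blocks π ≡ suc (later-blocks π)
#blocks-later {n} π =
  trans (length-fold (blocks π))
  (trans (ℕSum.fold-blocks π (λ _ → 1))
  (trans (ℕSum.fold-allFin-suc (λ i → count (does (min π i Fin.≟ i))))
         (cong (λ b → count b ℕ.+ later-blocks π)
           (dec-true (min π zero Fin.≟ zero) (min⁺ π zero λ _ _ → z≤n)))))

-- A point `i` is not last in its block of `Kr π` exactly if `i + 1` is first in its block of `π`.
-- The final point of the chain is always last, and the initial point always first, which accounts
-- for the subtracted 1.
excess-Kr : (π : NC n) → excess (Kr π) ≡ #blocks π ∸ 1
excess-Kr {zero}  π = refl
excess-Kr {suc n} π =
  trans (excess-nonmax (Kr π))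
  (trans (ℕSum.fold-allFin-last n (count ∘ nonmax (Kr π)))
  (trans (cong₂ ℕ._+_
           (ℕSum.fold-cong (allFin n) (λ i → cong count (shifted i)))
           (cong (count ∘ not) (dec-true (max (Kr π) (Fin.fromℕ n) Fin.≟ Fin.fromℕ n) last-max)))
  (trans (ℕ.+-identityʳ _) (cong (_∸ 1) (sym (#blocks-later π))))))
  where
  next : ∀ (i : Fin n) → toℕ (suc i) ≡ suc (toℕ (Fin.inject₁ i))
  next i = cong suc (sym (Fin.toℕ-inject₁ i))
  shifted : ∀ i → nonmax (Kr π) (Fin.inject₁ i) ≡ first π i
  shifted i = does-⇔
    (mk⇔ (Kr-nonmax⇒ π (Fin.inject₁ i) (suc i) (next i))
         (Kr-nonmax⇐ π (Fin.inject₁ i) (suc i) (next i)))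
    (¬? (max (Kr π) (Fin.inject₁ i) Fin.≟ Fin.inject₁ i)) (min π (suc i) Fin.≟ suc i)
  last-max : max (Kr π) (Fin.fromℕ n) ≡ Fin.fromℕ n
  last-max = Fin.≤-antisym (Fin.≤fromℕ _) (max-greatest (Kr π) {Fin.fromℕ n} refl)

1ₙ-same : ∀ {n} (i j : Fin n) → SameBlock 1ₙ i j
1ₙ-same i j = FromEquivalence.preserves {_~_ = λ _ _ → ⊤} (λ _ _ → yes tt) _ (λ _ _ _ _ _ → tt) tt

#blocks-1ₙ : ∀ n → #blocks (1ₙ {n}) ∸ 1 ≡ 0
#blocks-1ₙ zero    = refl
#blocks-1ₙ (suc n) = trans (cong (_∸ 1) (#blocks-later (1ₙ {suc n})))
  (trans (ℕSum.fold-cong (allFin n) λ i → cong count (dec-false (min 1ₙ (suc i) Fin.≟ suc i)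
           λ e → contradiction (min⁻ 1ₙ e {zero} (1ₙ-same (suc i) zero)) λ ()))
         (ℕSum.fold-ε (allFin n)))

-- With no block starting after `zero`, every label is `zero`. This turns properness of a variable
-- into positive degree.
one-block : (π : NC n) → #blocks π ∸ 1 ≡ 0 → π ≡ 1ₙ
one-block {zero}  π _  = NC-zero π
one-block {suc n} π eq = ≤-antisym π 1ₙ (λ i j _ → 1ₙ-same i j)
  (λ i j _ → trans (to-zero i) (sym (to-zero j)))
  where
  fold-zero : ∀ {a} {A : Set a} (xs : List A) (f : A → ℕ) →
              ℕSum.fold xs f ≡ 0 → All (λ x → f x ≡ 0) xs
  fold-zero []       f e = []
  fold-zero (x ∷ xs) f e = ℕ.m+n≡0⇒m≡0 (f x) e ∷ fold-zero xs f (ℕ.m+n≡0⇒n≡0 (f x) e)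
  no-later : ∀ i → count (first π i) ≡ 0
  no-later i = All.lookup
    (fold-zero (allFin n) (count ∘ first π) (trans (cong (_∸ 1) (sym (#blocks-later π))) eq))
    (∈-allFin i)
  zero-first : ∀ k → min π k ≡ k → k ≡ zero
  zero-first zero    _ = refl
  zero-first (suc k) e = contradiction
    (trans (sym (cong count (dec-true (min π (suc k) Fin.≟ suc k) e))) (no-later k)) λ ()
  to-zero : ∀ i → min π i ≡ zero
  to-zero i = zero-first (min π i) (min-same π i)

-- Completeness and uniqueness of the enumeration, and reindexing.

∈-mapMaybe⁺ : ∀ {a b} {A : Set a} {B : Set b} (p : A → Maybe B) {x y} xs →
              x ∈ xs → p x ≡ just y → y ∈ mapMaybe p xs
∈-mapMaybe⁺ p (x ∷ xs) (here refl) eq rewrite eq = here refl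
∈-mapMaybe⁺ p (x ∷ xs) (there x∈)  eq with p x
... | just _  = there (∈-mapMaybe⁺ p xs x∈ eq)
... | nothing = ∈-mapMaybe⁺ p xs x∈ eq

mapMaybe-unique : ∀ {a b} {A : Set a} {B : Set b} (p : A → Maybe B) (g : B → A) →
                  (∀ x y → p x ≡ just y → x ≡ g y) → ∀ {xs} → Unique xs → Unique (mapMaybe p xs)
mapMaybe-unique p g inv {[]}     _          = []
mapMaybe-unique p g inv {x ∷ xs} (x∉ ∷ un) with p x in eq
... | nothing = mapMaybe-unique p g inv un
... | just y  = fresh xs x∉ ∷ mapMaybe-unique p g inv un
  where
  fresh : ∀ xs → All (x ≢_) xs → All (y ≢_) (mapMaybe p xs)
  fresh []        _          = []
  fresh (x′ ∷ xs) (x≢ ∷ x∉) with p x′ in eq′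
  ... | nothing = fresh xs x∉
  ... | just y′ = (λ { refl → x≢ (trans (inv x y eq) (sym (inv x′ y eq′))) }) ∷ fresh xs x∉

allVec-complete : ∀ {a} {A : Set a} {xs : List A} → (∀ x → x ∈ xs) →
                  ∀ {m} (v : Vec A m) → v ∈ allVec xs m
allVec-complete all []      = here refl
allVec-complete all (x ∷ v) = ∈-cartesianProductWith⁺ _∷_ (all x) (allVec-complete all v)

allVec-unique : ∀ {a} {A : Set a} {xs : List A} → Unique xs → ∀ m → Unique (allVec xs m)
allVec-unique un zero    = [] ∷ []
allVec-unique un (suc m) = Unique.cartesianProductWith⁺ _∷_ Vec.∷-injective un (allVec-unique un m)

toNC-just : (v : Vec (Fin n) n) (π : NC n) → toNC v ≡ just π → v ≡ rep π
toNC-just v π eq with isNC? v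
toNC-just v .(mkNC v _) refl | yes p = refl

toNC-rep : (π : NC n) → toNC (rep π) ≡ just π
toNC-rep π with isNC? (rep π)
... | yes _ = refl
... | no ¬p = contradiction (isNC π) ¬p

allNC-complete : (π : NC n) → π ∈ allNC n
allNC-complete {n} π = ∈-mapMaybe⁺ toNC (allVec (allFin n) n)
  (allVec-complete ∈-allFin (rep π)) (toNC-rep π)

allNC-unique : ∀ n → Unique (allNC n)
allNC-unique n = mapMaybe-unique toNC rep toNC-just (allVec-unique (Unique.allFin⁺ n) n)

-- Both lists are free of repetitions, as the left inverse `g` makes `f` injective; equal membership
-- then gives a permutation.
reindex : ∀ {a b} {A : Set a} {B : Set b} (f : A → B) (g : B → A) → (∀ x → g (f x) ≡ x) →
          ∀ {xs ys} → Unique xs → Unique ys → (∀ x → x ∈ xs → f x ∈ ys) →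
          (∀ y → y ∈ ys → ∃[ x ] x ∈ xs × y ≡ f x) → List.map f xs ↭ ys
reindex f g gf {xs} {ys} uxs uys to from = ∼bag⇒↭ (unique∧set⇒bag
  (Unique.map⁺ (λ {x} {y} e → trans (sym (gf x)) (trans (cong g e) (gf y))) uxs) uys
  (mk⇔ to′ from′))
  where
  to′ : ∀ {y} → y ∈ List.map f xs → y ∈ ys
  to′ y∈ with x , x∈ , refl ← ∈-map⁻ f y∈ = to x x∈
  from′ : ∀ {y} → y ∈ ys → y ∈ List.map f xs
  from′ {y} y∈ with x , x∈ , refl ← from y y∈ = ∈-map⁺ f x∈

Kr⁻¹-permutes : ∀ n → List.map Kr⁻¹ (allNC n) ↭ allNC n
Kr⁻¹-permutes n = reindex Kr⁻¹ Kr Kr∘Kr⁻¹ (allNC-unique n) (allNC-unique n)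
  (λ π _ → allNC-complete (Kr⁻¹ π))
  (λ π _ → Kr π , allNC-complete (Kr π) , sym (Kr⁻¹∘Kr π))

-- `Kr` reverses the order, and the Galois connection places each preimage `Kr⁻¹ τ` above `π`.
Kr-intervals : (π : NC n) → List.map Kr (filter (π ≤?_) (allNC n)) ↭ filter (_≤? Kr π) (allNC n)
Kr-intervals {n} π = reindex Kr Kr⁻¹ Kr⁻¹∘Kr
  (Unique.filter⁺ (π ≤?_) (allNC-unique n)) (Unique.filter⁺ (_≤? Kr π) (allNC-unique n))
  (λ σ σ∈ → ∈-filter⁺ (_≤? Kr π) (allNC-complete (Kr σ))
    (Kr-antitone π σ (proj₂ (∈-filter⁻ (π ≤?_) {xs = allNC n} σ∈))))
  (λ τ τ∈ → Kr⁻¹ τ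
    , ∈-filter⁺ (π ≤?_) (allNC-complete (Kr⁻¹ τ))
        (galois⇐ π τ (proj₂ (∈-filter⁻ (_≤? Kr π) {xs = allNC n} τ∈)))
    , sym (Kr∘Kr⁻¹ τ))

-- Choosing a partition of every block.

module Choices {p} {P : Fin n → Set p} where

  -- A choice is an `All` because the type chosen from varies with `m`: blocks have different sizes.
  choices : (∀ m → List (P m)) → (ms : List (Fin n)) → List (All P ms)
  choices enum []       = [] ∷ []
  choices enum (m ∷ ms) = cartesianProductWith _∷_ (enum m) (choices enum ms)

  choices-complete : ∀ {enum} → (∀ m θ → θ ∈ enum m) → ∀ {ms} (θs : All P ms) → θs ∈ choices enum ms
  choices-complete all []       = here refl
  choices-complete all (θ ∷ θs) = ∈-cartesianProductWith⁺ _∷_ (all _ θ) (choices-complete all θs)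

  choices-unique : ∀ {enum} → (∀ m → Unique (enum m)) → ∀ ms → Unique (choices enum ms)
  choices-unique un []       = [] ∷ []
  choices-unique un (m ∷ ms) =
    Unique.cartesianProductWith⁺ _∷_ (λ { refl → refl , refl }) (un m) (choices-unique un ms)

  -- Extends a choice to the total function that `glue` expects, with `d` as the default outside the
  -- list.
  pick : (∀ m → P m) → ∀ {ms} → All P ms → ∀ m → P m
  pick d []       m = d m
  pick d (_∷_ {x = k} θ θs) m with k Fin.≟ m
  ... | yes refl = θ
  ... | no  _    = pick d θs m

  pick-universal : ∀ d f {ms m} → m ∈ ms → pick d (All.universal f ms) m ≡ f m
  pick-universal d f {k ∷ ms} {m} m∈ with k Fin.≟ m
  pick-universal d f {k ∷ ms} {m} m∈          | yes refl = refl
  pick-universal d f {k ∷ ms} {m} (here refl) | no k≢m = contradiction refl k≢m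
  pick-universal d f {k ∷ ms} {m} (there m∈)  | no _   = pick-universal d f m∈

  universal-pick : ∀ d f {ms} → Unique ms → (θs : All P ms) →
                   (∀ m → m ∈ ms → f m ≡ pick d θs m) → All.universal f ms ≡ θs
  universal-pick d f []         []       h = refl
  universal-pick d f {k ∷ ms} (k∉ ∷ un) (θ ∷ θs) h =
    cong₂ _∷_ head (universal-pick d f un θs tail)
    where
    head : f k ≡ θ
    head with e ← h k (here refl) with k Fin.≟ k
    ... | yes refl = e
    ... | no k≢k = contradiction refl k≢k
    tail : ∀ m → m ∈ ms → f m ≡ pick d θs m
    tail m m∈ with e ← h m (there m∈) with k Fin.≟ m
    ... | yes refl = contradiction refl (All.lookup k∉ m∈)
    ... | no _ = e

module _ (κ : NC n) where

  open Choices {P = λ m → NC ∣ block κ m ∣}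

  parts : (ms : List (Fin n)) → List (All (λ m → NC ∣ block κ m ∣) ms)
  parts = choices (λ m → allNC ∣ block κ m ∣)

  -- `1ₙ` only fills the indices that are not first points of blocks.
  glue-parts : All (λ m → NC ∣ block κ m ∣) (mins κ) → NC n
  glue-parts θs = glue κ (pick (λ _ → 1ₙ) θs)

  split : NC n → All (λ m → NC ∣ block κ m ∣) (mins κ)
  split τ = All.universal (λ m → τ ↾ block κ m) (mins κ)

  min-of-mins : ∀ m → m ∈ mins κ → min κ m ≡ m
  min-of-mins m m∈ = proj₂ (∈-filter⁻ (λ i → min κ i Fin.≟ i) {xs = allFin n} m∈)

  split-glue : ∀ θs → split (glue-parts θs) ≡ θs
  split-glue θs = universal-pick (λ _ → 1ₙ) (λ m → glue-parts θs ↾ block κ m)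
    (Unique.filter⁺ (λ i → min κ i Fin.≟ i) (Unique.allFin⁺ n)) θs
    λ m m∈ → glue-↾ κ (pick (λ _ → 1ₙ) θs) m (min-of-mins m m∈)

  glue-split : ∀ τ → τ ≤ κ → τ ≡ glue-parts (split τ)
  glue-split τ τ≤κ = glue-unique κ (pick (λ _ → 1ₙ) (split τ)) τ τ≤κ λ m m-min →
    sym (pick-universal (λ _ → 1ₙ) (λ m → τ ↾ block κ m)
      (∈-filter⁺ (λ i → min κ i Fin.≟ i) (∈-allFin m) m-min))

  glue-parts-permutes : List.map glue-parts (parts (mins κ)) ↭ filter (_≤? κ) (allNC n)
  glue-parts-permutes = reindex glue-parts split split-glue
    (choices-unique (λ m → allNC-unique ∣ block κ m ∣) (mins κ))
    (Unique.filter⁺ (_≤? κ) (allNC-unique n))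
    (λ θs _ → ∈-filter⁺ (_≤? κ) (allNC-complete (glue-parts θs)) (glue-≤ κ (pick (λ _ → 1ₙ) θs)))
    (λ τ τ∈ → split τ , choices-complete (λ m → allNC-complete) (split τ)
      , glue-split τ (proj₂ (∈-filter⁻ (_≤? κ) {xs = allNC n} τ∈)))

-- Products of sums in a commutative semiring.

module Distribute {c ℓ} (R : CommutativeSemiring c ℓ) where

  open CommutativeSemiring R
    using (Carrier; _≈_; _*_; 1#; *-congˡ; +-cong; distribˡ; distribʳ; zeroˡ; zeroʳ; reflexive; +-identityʳ)
    renaming (refl to ≈-refl; sym to ≈-sym; trans to ≈-trans)
  private
    module S = Fold (CommutativeSemiring.+-commutativeMonoid R)
    module Π = Fold (CommutativeSemiring.*-commutativeMonoid R)

  sum-cartesianProductWith : ∀ {a b d} {A : Set a} {B : Set b} {D : Set d}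
    (f : A → B → D) xs ys (g : D → Carrier) →
    S.fold (cartesianProductWith f xs ys) g ≈ S.fold xs (λ x → S.fold ys (λ y → g (f x y)))
  sum-cartesianProductWith f []       ys g = ≈-refl
  sum-cartesianProductWith f (x ∷ xs) ys g = ≈-trans
    (S.fold-++ (List.map (f x) ys) (cartesianProductWith f xs ys) g)
    (+-cong (reflexive (S.fold-map (f x) ys g)) (sum-cartesianProductWith f xs ys g))

  *-sum : ∀ {a} {A : Set a} x ys (g : A → Carrier) → x * S.fold ys g ≈ S.fold ys (λ y → x * g y)
  *-sum x []       g = zeroʳ x
  *-sum x (y ∷ ys) g = ≈-trans (distribˡ x _ _) (+-cong ≈-refl (*-sum x ys g))

  sum-* : ∀ {a} {A : Set a} y xs (g : A → Carrier) → S.fold xs g * y ≈ S.fold xs (λ x → g x * y)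
  sum-* y []       g = zeroˡ y
  sum-* y (x ∷ xs) g = ≈-trans (distribʳ y _ _) (+-cong ≈-refl (sum-* y xs g))

  module _ {p} {P : Fin n → Set p} (F : ∀ m → P m → Carrier) where

    open Choices {P = P}

    ∏ : ∀ {ms} → All P ms → Carrier
    ∏ []             = 1#
    ∏ (_∷_ {x = m} θ θs) = F m θ * ∏ θs

    ∏-universal : ∀ f ms → ∏ (All.universal f ms) ≡ Π.fold ms (λ m → F m (f m))
    ∏-universal f []       = refl
    ∏-universal f (m ∷ ms) = cong (F m (f m) *_) (∏-universal f ms)

    product-of-sums : ∀ enum ms → Π.fold ms (λ m → S.fold (enum m) (F m)) ≈ S.fold (choices enum ms) ∏
    product-of-sums enum []       = ≈-sym (+-identityʳ 1#)
    product-of-sums enum (m ∷ ms) =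
      ≈-trans (*-congˡ (product-of-sums enum ms))
      (≈-trans (sum-* (S.fold (choices enum ms) ∏) (enum m) (F m))
      (≈-trans (S.fold-cong (enum m) λ θ → *-sum (F m θ) (choices enum ms) ∏)
      (≈-sym (sum-cartesianProductWith _∷_ (enum m) (choices enum ms) ∏))))

  -- Expanding the product gives one term per choice of a partition for every block of `κ`; gluing
  -- identifies these choices with the partitions `τ ≤ κ`.
  product-over-blocks : (κ : NC n) (F : ∀ m → NC ∣ block κ m ∣ → Carrier) →
    Π.fold (mins κ) (λ m → S.fold (allNC ∣ block κ m ∣) (F m)) ≈
    S.fold (filter (_≤? κ) (allNC n)) (λ τ → Π.fold (mins κ) (λ m → F m (τ ↾ block κ m)))
  product-over-blocks {n} κ F =
    ≈-trans (product-of-sums F (λ m → allNC ∣ block κ m ∣) (mins κ))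
    (≈-trans (S.fold-cong (parts κ (mins κ)) λ θs → reflexive
               (trans (cong (∏ F) (sym (split-glue κ θs)))
                      (∏-universal F (λ m → glue-parts κ θs ↾ block κ m) (mins κ))))
    (≈-trans (reflexive (sym (S.fold-map (glue-parts κ) (parts κ (mins κ)) H)))
             (S.fold-↭ H (glue-parts-permutes κ))))
    where
    H : NC n → Carrier
    H τ = Π.fold (mins κ) (λ m → F m (τ ↾ block κ m))

-- The homomorphism Ψ

module Homomorphism {c ℓ} (K : CommutativeRing c ℓ) where

  open Over K

  private
    module K = CommutativeRing K
    module 𝕊 = Algebra Sym-algebra
    module 𝕊⊗𝕊 = Algebra (Sym-algebra ⊗ Sym-algebra)
    module Prod = Fold 𝕊.*-commutativeMonoid
    module Sum = Fold 𝕊⊗𝕊.+-commutativeMonoid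
    module Prod⊗ = Fold 𝕊⊗𝕊.*-commutativeMonoid
    open Tensor Sym-algebra Sym-algebra using (⊗-cong) renaming (_⊗_ to _⊗ᵗ_)

    Δˢ = RawGradedBialgebra.Δ Sym
    εˢ = RawGradedBialgebra.ε Sym
    Δᵗ = RawGradedBialgebra.Δ 𝒯

  -- Values of `Ψ` on generators, and the counit.

  product-Y-trivial : ∀ {a} {A : Set a} (size : A → ℕ) xs →
                      ℕSum.fold xs (λ x → size x ∸ 1) ≡ 0 → 𝕊.product xs (Y ∘ size) 𝕊.≈ 𝕊.1#
  product-Y-trivial size []       _ = 𝕊.refl
  product-Y-trivial size (x ∷ xs) e with size x
  ... | 0 = 𝕊.trans (𝕊.*-identityˡ _) (product-Y-trivial size xs e)
  ... | 1 = 𝕊.trans (𝕊.*-identityˡ _) (product-Y-trivial size xs e)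

  -- Some size is at least 2, and the counit kills its variable.
  ε-product-Y : ∀ {a} {A : Set a} (size : A → ℕ) xs →
                ℕSum.fold xs (λ x → size x ∸ 1) ≢ 0 → εˢ (𝕊.product xs (Y ∘ size)) K.≈ K.0#
  ε-product-Y size []       e = contradiction refl e
  ε-product-Y size (x ∷ xs) e with size x
  ... | 0 = K.trans (K.*-identityˡ _) (ε-product-Y size xs e)
  ... | 1 = K.trans (K.*-identityˡ _) (ε-product-Y size xs e)
  ... | suc (suc k) = K.zeroˡ _

  X-cases : (π : NC n) → (π ≡ 1ₙ × X π ≡ P𝒯.con K.1#) ⊎
                         (∃[ v ] X π ≡ P𝒯.var v × Ψ (P𝒯.var v) ≡ Yₚ (Kr π))
  X-cases π with π ≟ 1ₙ
  ... | yes e = inj₁ (e , refl)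
  ... | no ≢1 = inj₂ (mkVar π ≢1 , refl , refl)

  -- For `π ≡ 1ₙ` the content is that `Kr π` has no block of size 2 or more, which follows from its
  -- excess being 0; all factors are then 1.
  Ψ-X : (π : NC n) → Ψ (X π) 𝕊.≈ Yₚ (Kr π)
  Ψ-X {n} π = go (X-cases π)
    where
    go : _ → Ψ (X π) 𝕊.≈ Yₚ (Kr π)
    go (inj₁ (e , e′)) = 𝕊.trans (𝕊.reflexive (cong Ψ e′)) (𝕊.sym
      (product-Y-trivial ∣_∣ (blocks (Kr π))
        (trans (excess-Kr π) (trans (cong (λ σ → #blocks σ ∸ 1) e) (#blocks-1ₙ n)))))
    go (inj₂ (v , e , e′)) = 𝕊.reflexive (trans (cong Ψ e) e′)

  ε-Ψ : ∀ x → εˢ (Ψ x) K.≈ RawGradedBialgebra.ε 𝒯 x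
  ε-Ψ (P𝒯.con k)  = K.refl
  -- If the excess of `Kr π` vanished, `π` would have one block. As `proper` is an irrelevant field,
  -- it is refuted through `⊥-irr`.
  ε-Ψ (P𝒯.var (mkVar π π≢1ₙ)) = ε-product-Y ∣_∣ (blocks (Kr π)) λ e →
    ⊥-irr (π≢1ₙ (one-block π (trans (sym (excess-Kr π)) e)))
  ε-Ψ (x P𝒯.:+ y) = K.+-cong (ε-Ψ x) (ε-Ψ y)
  ε-Ψ (x P𝒯.:* y) = K.*-cong (ε-Ψ x) (ε-Ψ y)

  -- The grading.

  Y-variables : ℕ → List ℕ
  Y-variables (suc (suc k)) = k ∷ []
  Y-variables _             = []

  degree : List ℕ → ℕ
  degree is = ℕ.sum (List.map suc is)

  Y-monomial : ∀ m → Y m 𝕊.≈ PSym.monomial (Y-variables m)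
  Y-monomial 0             = 𝕊.refl
  Y-monomial 1             = 𝕊.refl
  Y-monomial (suc (suc k)) = 𝕊.sym (𝕊.*-identityʳ _)

  Y-degree : ∀ m → degree (Y-variables m) ≡ m ∸ 1
  Y-degree 0             = refl
  Y-degree 1             = refl
  Y-degree (suc (suc k)) = ℕ.+-identityʳ (suc k)

  product-monomial : ∀ {a} {A : Set a} (f : A → 𝕊.Carrier) (w : A → List ℕ) →
                     (∀ x → f x 𝕊.≈ PSym.monomial (w x)) →
                     ∀ xs → 𝕊.product xs f 𝕊.≈ PSym.monomial (List.concatMap w xs)
  product-monomial f w h []       = 𝕊.refl
  product-monomial f w h (x ∷ xs) = 𝕊.trans (𝕊.*-cong (h x) (product-monomial f w h xs))
    (𝕊.sym (Prod.fold-++ (w x) (List.concatMap w xs) PSym.var))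

  degree-concatMap : ∀ {a} {A : Set a} (w : A → List ℕ) (d : A → ℕ) → (∀ x → degree (w x) ≡ d x) →
                     ∀ xs → degree (List.concatMap w xs) ≡ ℕ.sum (List.map d xs)
  degree-concatMap w d h []       = refl
  degree-concatMap w d h (x ∷ xs) =
    trans (cong ℕ.sum (List.map-++ suc (w x) (List.concatMap w xs)))
    (trans (ℕ.sum-++ (List.map suc (w x)) _) (cong₂ ℕ._+_ (h x) (degree-concatMap w d h xs)))

  Yₚ-variables : NC n → List ℕ
  Yₚ-variables π = List.concatMap (λ V → Y-variables ∣ V ∣) (blocks π)

  Yₚ-monomial : (π : NC n) → Yₚ π 𝕊.≈ PSym.monomial (Yₚ-variables π)
  Yₚ-monomial π = product-monomial
    (λ V → Y ∣ V ∣) (λ V → Y-variables ∣ V ∣) (λ V → Y-monomial ∣ V ∣) (blocks π)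

  Yₚ-degree : (π : NC n) → degree (Yₚ-variables π) ≡ excess π
  Yₚ-degree π = trans
    (degree-concatMap (λ V → Y-variables ∣ V ∣) (λ V → ∣ V ∣ ∸ 1) (λ V → Y-degree ∣ V ∣) (blocks π))
    (List.foldr-map ℕ._+_ (λ V → ∣ V ∣ ∸ 1) 0 (blocks π))

  Ψ-variables : Var𝒯 → List ℕ
  Ψ-variables v = Yₚ-variables (Kr (Var𝒯.part v))

  Ψ-product : ∀ {a} {A : Set a} xs (f : A → Algebra.Carrier 𝒯-algebra) →
              Ψ (Algebra.product 𝒯-algebra xs f) ≡ 𝕊.product xs (Ψ ∘ f)
  Ψ-product []       f = refl
  Ψ-product (x ∷ xs) f = cong (Ψ (f x) PSym.:*_) (Ψ-product xs f)

  Ψ-monomial : ∀ vs → Ψ (P𝒯.monomial vs) 𝕊.≈ PSym.monomial (List.concatMap Ψ-variables vs)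
  Ψ-monomial vs = 𝕊.trans (𝕊.reflexive (Ψ-product vs P𝒯.var))
    (product-monomial (Ψ ∘ P𝒯.var) Ψ-variables (λ v → Yₚ-monomial (Kr (Var𝒯.part v))) vs)

  Ψ-degree : ∀ vs → degree (List.concatMap Ψ-variables vs) ≡
                    ℕ.sum (List.map (λ v → #blocks (Var𝒯.part v) ∸ 1) vs)
  Ψ-degree = degree-concatMap Ψ-variables _ λ v →
    trans (Yₚ-degree (Kr (Var𝒯.part v))) (excess-Kr (Var𝒯.part v))

  -- `Ψ` sends a monomial to a monomial of the same degree, by `excess-Kr`, so a homogeneous
  -- combination is mapped term by term.
  Ψ-graded : ∀ d x → RawGradedBialgebra.Homogeneous 𝒯 d x →
             RawGradedBialgebra.Homogeneous Sym d (Ψ x)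
  Ψ-graded d x (ts , degrees , x∼) =
      List.map image ts
    , All.map⁺ (All.map (λ {(k , vs)} e → trans (Ψ-degree vs) e) degrees)
    , 𝕊.trans (P𝒯.eval-cong Sym-algebra _ x∼) (terms ts)
    where
    image : K.Carrier × List Var𝒯 → K.Carrier × List ℕ
    image (k , vs) = k , List.concatMap Ψ-variables vs
    terms : ∀ ts → Ψ (Algebra.sum 𝒯-algebra ts (λ (k , vs) → P𝒯.con k P𝒯.:* P𝒯.monomial vs)) 𝕊.≈
                   𝕊.sum (List.map image ts) (λ (k , is) → PSym.con k PSym.:* PSym.monomial is)
    terms []              = 𝕊.refl
    terms ((k , vs) ∷ ts) = 𝕊.+-cong (𝕊.*-congˡ (Ψ-monomial vs)) (terms ts)

  -- The comultiplication.

  -- `Δˢ` is prescribed on the variables only; at `m = 1` the formula has the single term 1 ⊗ 1, in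
  -- accordance with the convention for `Y 1`.
  Δ-Y-correct : ∀ m → m ≢ 0 → Δˢ (Y m) 𝕊⊗𝕊.≈ Δ-Y m
  Δ-Y-correct 0             m≢0 = contradiction refl m≢0
  Δ-Y-correct 1             _   = 𝕊⊗𝕊.sym (⊗-cong (𝕊.*-identityʳ _) (𝕊.*-identityʳ _))
  Δ-Y-correct (suc (suc k)) _   = 𝕊⊗𝕊.refl

  Δ-product : ∀ {a} {A : Set a} xs (f : A → 𝕊.Carrier) →
              Δˢ (𝕊.product xs f) 𝕊⊗𝕊.≈ 𝕊⊗𝕊.product xs (Δˢ ∘ f)
  Δ-product []       f = 𝕊⊗𝕊.refl
  Δ-product (x ∷ xs) f = 𝕊⊗𝕊.*-congˡ {x = Δˢ (f x)} (Δ-product xs f)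

  product-⊗ : ∀ {a} {A : Set a} xs (f g : A → 𝕊.Carrier) →
              𝕊⊗𝕊.product xs (λ x → f x ⊗ᵗ g x) 𝕊⊗𝕊.≈ 𝕊.product xs f ⊗ᵗ 𝕊.product xs g
  product-⊗ []       f g = 𝕊⊗𝕊.refl
  product-⊗ (x ∷ xs) f g = 𝕊⊗𝕊.*-congˡ {x = f x ⊗ᵗ g x} (product-⊗ xs f g)

  -- Substituting `Kr⁻¹ θ` for the summation index makes the second factor `Yₚ θ`, so that `θ` can
  -- become the restriction of one `τ ≤ κ`.
  Δ-Y-reindexed : ∀ m → Δ-Y m 𝕊⊗𝕊.≈ Sum.fold (allNC m) (λ θ → Yₚ (Kr⁻¹ θ) ⊗ᵗ Yₚ θ)
  Δ-Y-reindexed m = 𝕊⊗𝕊.trans (𝕊⊗𝕊.sym (Sum.fold-↭ summand (Kr⁻¹-permutes m)))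
    (𝕊⊗𝕊.trans (𝕊⊗𝕊.reflexive (Sum.fold-map Kr⁻¹ (allNC m) summand))
      (Sum.fold-cong (allNC m) λ θ → 𝕊⊗𝕊.reflexive (cong (λ τ → Yₚ (Kr⁻¹ θ) ⊗ᵗ Yₚ τ) (Kr∘Kr⁻¹ θ))))
    where
    summand : NC m → 𝕊⊗𝕊.Carrier
    summand θ = Yₚ θ ⊗ᵗ Yₚ (Kr θ)

  Yₚ-refine : (ρ σ : NC n) → ρ ≤ σ → 𝕊.product (mins σ) (λ m → Yₚ (ρ ↾ block σ m)) 𝕊.≈ Yₚ ρ
  Yₚ-refine ρ σ ρ≤σ = FoldBlocks.fold-refine 𝕊.*-commutativeMonoid ρ σ ρ≤σ Y

  Yₚ-KrIn : (σ π : NC n) → 𝕊.product (mins σ) (λ m → Yₚ (Kr (π ↾ block σ m))) 𝕊.≈ Yₚ (KrIn σ π)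
  Yₚ-KrIn {n} σ π = 𝕊.trans
    (Prod.fold-congᴬ (All.map (λ {m} e → 𝕊.reflexive (cong Yₚ (sym (KrIn-↾ σ π m e))))
      (All.all-filter (λ i → min σ i Fin.≟ i) (allFin n))))
    (Yₚ-refine (KrIn σ π) σ (KrIn-≤ σ π))

  Yₚ-Kr⁻¹In : (κ τ : NC n) → 𝕊.product (mins κ) (λ m → Yₚ (Kr⁻¹ (τ ↾ block κ m))) 𝕊.≈ Yₚ (Kr⁻¹In κ τ)
  Yₚ-Kr⁻¹In {n} κ τ = 𝕊.trans
    (Prod.fold-congᴬ (All.map (λ {m} e → 𝕊.reflexive (cong Yₚ (sym (Kr⁻¹In-↾ κ τ m e))))
      (All.all-filter (λ i → min κ i Fin.≟ i) (allFin n))))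
    (Yₚ-refine (Kr⁻¹In κ τ) κ (Kr⁻¹In-≤ κ τ))

  Ψ-restrictions : (π σ : NC n) → π ≤ σ →
    Ψ (Algebra.product 𝒯-algebra (blocks σ) (λ W → X (π ↾ W))) 𝕊.≈ Yₚ (KrIn σ π)
  Ψ-restrictions π σ π≤σ =
    𝕊.trans (𝕊.reflexive (Ψ-product (blocks σ) (λ W → X (π ↾ W))))
    (𝕊.trans (Prod.fold-cong (blocks σ) (λ W → Ψ-X (π ↾ W)))
    (𝕊.trans (𝕊.reflexive (Prod.fold-map (block σ) (mins σ) (λ W → Yₚ (Kr (π ↾ W)))))
             (Yₚ-KrIn σ π)))

  term : (κ τ : NC n) → 𝕊⊗𝕊.Carrier
  term κ τ = 𝕊⊗𝕊.product (mins κ) (λ m → Yₚ (Kr⁻¹ (τ ↾ block κ m)) ⊗ᵗ Yₚ (τ ↾ block κ m))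

  -- The product splits into its tensor factors. On the left, `KrIn≡Kr⁻¹In` matches the complements
  -- in the blocks of `σ` with the inverse complements in the blocks of `Kr π`; on the right, the
  -- restrictions of `Kr σ` recombine to `Yₚ (Kr σ)`.
  term-Kr : (π σ : NC n) → π ≤ σ → term (Kr π) (Kr σ) 𝕊⊗𝕊.≈
    Ψ (Algebra.product 𝒯-algebra (blocks σ) (λ W → X (π ↾ W))) ⊗ᵗ Ψ (X σ)
  term-Kr π σ π≤σ = 𝕊⊗𝕊.trans
    (product-⊗ (mins κ) (λ m → Yₚ (Kr⁻¹ (τ ↾ block κ m))) (λ m → Yₚ (τ ↾ block κ m)))
    (⊗-cong
      (𝕊.trans (Yₚ-Kr⁻¹In κ τ) (𝕊.trans (𝕊.reflexive (cong Yₚ (sym (KrIn≡Kr⁻¹In π σ π≤σ))))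
        (𝕊.sym (Ψ-restrictions π σ π≤σ))))
      (𝕊.trans (Yₚ-refine τ κ (Kr-antitone π σ π≤σ)) (𝕊.sym (Ψ-X σ))))
    where
    κ = Kr π
    τ = Kr σ

  Δ-Yₚ : (κ : NC n) → Δˢ (Yₚ κ) 𝕊⊗𝕊.≈ Sum.fold (filter (_≤? κ) (allNC n)) (term κ)
  Δ-Yₚ κ =
    𝕊⊗𝕊.trans (Δ-product (blocks κ) (λ V → Y ∣ V ∣))
    (𝕊⊗𝕊.trans (𝕊⊗𝕊.reflexive (Prod⊗.fold-map (block κ) (mins κ) (λ V → Δˢ (Y ∣ V ∣))))
    (𝕊⊗𝕊.trans (Prod⊗.fold-cong (mins κ) (λ m → 𝕊⊗𝕊.trans
        (Δ-Y-correct ∣ block κ m ∣ (nonempty m)) (Δ-Y-reindexed ∣ block κ m ∣)))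
      (Distribute.product-over-blocks 𝕊⊗𝕊.commutativeSemiring κ (λ m θ → Yₚ (Kr⁻¹ θ) ⊗ᵗ Yₚ θ))))
    where
    nonempty : ∀ m → ∣ block κ m ∣ ≢ 0
    nonempty m e with () ← subst Fin e (proj₁ (block-point κ m m refl))

  Ψ⊗Ψ-sum : ∀ {a} {A : Set a} xs (f g : A → Algebra.Carrier 𝒯-algebra) →
    (Ψ ⊗ₕ Ψ) (Algebra.sum (𝒯-algebra ⊗ 𝒯-algebra) xs (λ x → (f x , g x) ∷ [])) ≡
    Sum.fold xs (λ x → Ψ (f x) ⊗ᵗ Ψ (g x))
  Ψ⊗Ψ-sum []       f g = refl
  Ψ⊗Ψ-sum (x ∷ xs) f g = cong ((Ψ (f x) , Ψ (g x)) ∷_) (Ψ⊗Ψ-sum xs f g)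

  -- The sum over `τ ≤ Kr π` becomes one over `σ ≥ π` through `τ = Kr σ`, and then agrees term by
  -- term.
  Δ-Ψ-var : (π : NC n) → Δˢ (Yₚ (Kr π)) 𝕊⊗𝕊.≈ (Ψ ⊗ₕ Ψ) (Δ-X π)
  Δ-Ψ-var {n} π =
    𝕊⊗𝕊.trans (Δ-Yₚ (Kr π))
    (𝕊⊗𝕊.trans (𝕊⊗𝕊.sym (Sum.fold-↭ (term (Kr π)) (Kr-intervals π)))
    (𝕊⊗𝕊.trans (𝕊⊗𝕊.reflexive (Sum.fold-map Kr above (term (Kr π))))
    (𝕊⊗𝕊.trans (Sum.fold-congᴬ (All.map (λ {σ} → term-Kr π σ) (All.all-filter (π ≤?_) (allNC n))))
      (𝕊⊗𝕊.reflexive (sym (Ψ⊗Ψ-sum above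
        (λ σ → Algebra.product 𝒯-algebra (blocks σ) (λ W → X (π ↾ W))) X))))))
    where
    above = filter (π ≤?_) (allNC n)

  -- An equality of lists, since `Ψ` commutes with products by definition.
  Ψ⊗Ψ-* : ∀ u v → (Ψ ⊗ₕ Ψ) (Algebra._*_ (𝒯-algebra ⊗ 𝒯-algebra) u v) ≡ (Ψ ⊗ₕ Ψ) u 𝕊⊗𝕊.* (Ψ ⊗ₕ Ψ) v
  Ψ⊗Ψ-* []      v = refl
  Ψ⊗Ψ-* (p ∷ u) v = trans (List.map-++ _ (List.map _ v) _) (cong₂ _++_
    (trans (sym (List.map-∘ v)) (List.map-∘ v)) (Ψ⊗Ψ-* u v))

  Δ-Ψ : ∀ x → Δˢ (Ψ x) 𝕊⊗𝕊.≈ (Ψ ⊗ₕ Ψ) (Δᵗ x)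
  Δ-Ψ (P𝒯.con k)  = 𝕊⊗𝕊.refl
  Δ-Ψ (P𝒯.var v)  = Δ-Ψ-var (Var𝒯.part v)
  Δ-Ψ (x P𝒯.:+ y) = 𝕊⊗𝕊.trans (𝕊⊗𝕊.+-cong (Δ-Ψ x) (Δ-Ψ y))
    (𝕊⊗𝕊.reflexive (sym (List.map-++ _ (Δᵗ x) (Δᵗ y))))
  Δ-Ψ (x P𝒯.:* y) = 𝕊⊗𝕊.trans (𝕊⊗𝕊.*-cong (Δ-Ψ x) (Δ-Ψ y))
    (𝕊⊗𝕊.reflexive (sym (Ψ⊗Ψ-* (Δᵗ x) (Δᵗ y))))

theorem14p6 : ∀ {c ℓ} (K : CommutativeRing c ℓ) →
    let open Over K in
    (∀ (n : ℕ) .{{_ : NonZero n}} (π : NC n) → RawGradedBialgebra._≈_ Sym (Ψ (X π)) (Yₚ (Kr π)))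
    × IsGradedBialgebraHom 𝒯 Sym Ψ
theorem14p6 K = (λ n π → Homomorphism.Ψ-X K π) , record
  { isAlgebraHom = P𝒯.eval-isAlgebraHom Sym-algebra _
  ; Δ-commutes   = Homomorphism.Δ-Ψ K
  ; ε-commutes   = Homomorphism.ε-Ψ K
  ; graded       = Homomorphism.Ψ-graded K
  }
  where open Over K
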